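{- For every constant $\varepsilon\in(0,1]$, there exists a semi-streaming algorithm that assumes access to an estimate $\tau$ of $f(OPT)$ obeying $(1-\varepsilon/8)\cdot f(OPT)\le \tau\le f(OPT)$ and provides a $(3+\varepsilon)$-approximation for the problem of maximizing a non-negative submodular function subject to a cardinality constraint. This algorithm stores at most $O(k\varepsilon^{ -1})$ elements.
   Context: Problem: given a finite ground set $N$, a non-negative submodular function $f\colon 2^N\to\mathbb{R}_{\ge 0}$ (accessed through a value oracle) and a positive integer $k$, find $S\subseteq N$ with $|S|\le k$ maximizing $f(S)$; $OPT$ denotes an optimal solution. A (possibly randomized) algorithm is a $\beta$-approximation if its output $S$ is always feasible and $\mathbb{E}[f(S)]\ge f(OPT)/\beta$. In the data stream model the elements of $N$ arrive one at a time in an arbitrary order and are processed in a single pass; a semi-streaming algorithm uses memory $O(k\cdot\mathrm{polylog}(k,|N|))$. No bound on running time is claimed. -}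

module Defs where

open import Algebra.Bundles using (CommutativeRing)
import Algebra.Definitions.RawMonoid as RawMonoid
open import Data.Bool.Base using (Bool; if_then_else_)
open import Data.Fin.Base using (Fin)
open import Data.Fin.Subset using (Subset; ⊥; ⁅_⁆; _∪_; _∩_; ∣_∣)
open import Data.List.Base using (List; []; _∷_; length; foldr; allFin)
open import Data.List.Relation.Binary.Permutation.Propositional using (_↭_)
import Data.Nat.Base as ℕ
open import Data.Nat.Base using (ℕ; zero; suc)
open import Data.Nat.Logarithm using (⌊log₂_⌋)
open import Data.Product.Base using (∃-syntax; _×_)
open import Function.Base using (_∘_)
open import Function.Definitions using (Injective)
open import Level using (_⊔_) renaming (suc to lsuc)
open import Relation.Binary.Core using (Rel)
open import Relation.Binary.Structures using (IsDecTotalOrder)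
open import Relation.Binary.PropositionalEquality.Core using (_≡_)
open import Relation.Nullary.Decidable.Core using (does)
open import Relation.Nullary.Negation.Core using (¬_)

-- The numbers.  The library has no real numbers, so the codomain of f is an
-- arbitrary Archimedean linearly ordered field.  The (classical) reals are an
-- instance, and so are the rationals.

record ArchimedeanOrderedField c ℓ₁ ℓ₂ : Set (lsuc (c ⊔ ℓ₁ ⊔ ℓ₂)) where
  field
    commutativeRing : CommutativeRing c ℓ₁

  open CommutativeRing commutativeRing public

  infix  4 _≤_ _<_
  infix  9 _⁻¹
  infixl 7 _÷_

  field
    _≤_             : Rel Carrier ℓ₂
    isDecTotalOrder : IsDecTotalOrder _≈_ _≤_
    +-monoˡ-≤       : ∀ {x y} z → x ≤ y → x + z ≤ y + z
    *-nonNegative   : ∀ {x y} → 0# ≤ x → 0# ≤ y → 0# ≤ x * y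
    0≉1             : ¬ 0# ≈ 1#
    -- Total for convenience; nothing is assumed about 0# ⁻¹.
    _⁻¹             : Carrier → Carrier
    *-inverseʳ      : ∀ {x} → ¬ x ≈ 0# → x * x ⁻¹ ≈ 1#
    archimedean     : ∀ x → ∃[ n ] x ≤ RawMonoid._×_ +-rawMonoid n 1#

  open IsDecTotalOrder isDecTotalOrder public using (_≤?_)

  fromℕ : ℕ → Carrier
  fromℕ n = RawMonoid._×_ +-rawMonoid n 1#

  _<_ : Rel Carrier (ℓ₁ ⊔ ℓ₂)
  x < y = x ≤ y × ¬ x ≈ y

  _÷_ : Carrier → Carrier → Carrier
  x ÷ y = x * y ⁻¹

-- The computational model: a machine that reads the stream once and whose
-- memory consists of
--   * a control state, charged the length of its binary code;
--   * a list of stored elements of the ground set;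
--   * a list of stored numbers (oracle answers and results of arithmetic).
-- Ground-set elements are opaque tokens: they can be stored, discarded, put
-- in an oracle query or in the output, but not converted to bits or numbers.
-- In particular the oracle can be asked only about sets of stored elements.
-- Stored elements and numbers are addressed by position, the most recently
-- stored being at position 0; a predicate on positions designates a set.

data Op : Set where
  add sub mul div : Op

data Instruction (State : Set) : Set where
  -- Store the next stream element and enter the first state; if the stream
  -- has ended, enter the second.
  read         : State → State → Instruction State
  keepElements : (ℕ → Bool) → State → Instruction State
  keepNumbers  : (ℕ → Bool) → State → Instruction State
  query        : (ℕ → Bool) → State → Instruction State
  constant     : ℕ → State → Instruction State
  arith        : Op → ℕ → ℕ → State → Instruction State
  -- Enter the first state if number i ≤ number j, and the second otherwise.
  compare      : (i j : ℕ) → State → State → Instruction State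
  -- A fair coin.
  toss         : State → State → Instruction State
  output       : (ℕ → Bool) → Instruction State

-- One machine serves every cardinality bound k, which it receives through its
-- initial state; it is not told the size of the ground set.

record Machine : Set₁ where
  field
    State          : Set
    code           : State → List Bool
    code-injective : Injective _≡_ _≡_ code
    start          : (k : ℕ) → State
    program        : State → Instruction State

select : ∀ {a} {A : Set a} → (ℕ → Bool) → List A → List A
select p []       = []
select p (x ∷ xs) =
  if p 0 then x ∷ select (p ∘ suc) xs else select (p ∘ suc) xs

toSubset : ∀ {n} → List (Fin n) → Subset n
toSubset = foldr (λ x S → ⁅ x ⁆ ∪ S) ⊥

module _ {c ℓ₁ ℓ₂} (K : ArchimedeanOrderedField c ℓ₁ ℓ₂) where
  open ArchimedeanOrderedField K

  NonNegative : ∀ {n} → (Subset n → Carrier) → Set ℓ₂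
  NonNegative f = ∀ A → 0# ≤ f A

  Submodular : ∀ {n} → (Subset n → Carrier) → Set ℓ₂
  Submodular f = ∀ A B → f (A ∪ B) + f (A ∩ B) ≤ f A + f B

  IsOptimal : ∀ {n} → (Subset n → Carrier) → ℕ → Subset n → Set ℓ₂
  IsOptimal f k S = ∣ S ∣ ℕ.≤ k × (∀ T → ∣ T ∣ ℕ.≤ k → f T ≤ f S)

  -- An input together with the estimate τ that the algorithm is promised.
  -- The machine's access to it is limited to k, τ, the stream and the oracle
  -- f; OPT only serves to state the promise and the approximation guarantee.
  record Instance (ε : Carrier) : Set (c ⊔ ℓ₂) where
    field
      n            : ℕ
      k            : ℕ
      k-positive   : 1 ℕ.≤ k
      f            : Subset n → Carrier
      nonNegative  : NonNegative f
      submodular   : Submodular f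
      stream       : List (Fin n)
      arrivalOrder : stream ↭ allFin n
      OPT          : Subset n
      optimal      : IsOptimal f k OPT
      τ            : Carrier
      τ-lower      : (1# - ε ÷ fromℕ 8) * f OPT ≤ τ
      τ-upper      : τ ≤ f OPT

  applyOp : Op → Carrier → Carrier → Carrier
  applyOp add x y = x + y
  applyOp sub x y = x - y
  applyOp mul x y = x * y
  applyOp div x y = x ÷ y

  numberAt : List Carrier → ℕ → Carrier
  numberAt []       _       = 0#
  numberAt (x ∷ xs) zero    = x
  numberAt (x ∷ xs) (suc i) = numberAt xs i

  module Execution (M : Machine) {ε : Carrier} (I : Instance ε) where
    open Machine M
    open Instance I

    record Configuration : Set c where
      constructor config
      field
        state    : State
        elements : List (Fin n)
        numbers  : List Carrier
        -- The part of the stream still to arrive; not part of the memory.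
        unread   : List (Fin n)

    data Outcome : Set c where
      halt     : Subset n → Outcome
      continue : Configuration → Outcome
      branch   : Configuration → Configuration → Outcome

    execute : Instruction State → List (Fin n) → List Carrier → List (Fin n) → Outcome
    execute (read q q′) es xs []               = continue (config q′ es xs [])
    execute (read q q′) es xs (u ∷ us)         = continue (config q (u ∷ es) xs us)
    execute (keepElements p q) es xs us        = continue (config q (select p es) xs us)
    execute (keepNumbers p q) es xs us         = continue (config q es (select p xs) us)
    execute (query p q) es xs us               =
      continue (config q es (f (toSubset (select p es)) ∷ xs) us)
    execute (constant m q) es xs us            = continue (config q es (fromℕ m ∷ xs) us)
    execute (arith op i j q) es xs us          =
      continue (config q es (applyOp op (numberAt xs i) (numberAt xs j) ∷ xs) us)
    execute (compare i j q q′) es xs us        =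
      continue (config (if does (numberAt xs i ≤? numberAt xs j) then q else q′) es xs us)
    execute (toss q q′) es xs us               = branch (config q es xs us) (config q′ es xs us)
    execute (output p) es xs us                = halt (toSubset (select p es))

    step : Configuration → Outcome
    step (config q es xs us) = execute (program q) es xs us

    initial : Configuration
    initial = config (start k) [] (τ ∷ []) stream

    data Reachable : Configuration → Set c where
      here  : Reachable initial
      next  : ∀ {γ γ′} → Reachable γ → step γ ≡ continue γ′ → Reachable γ′
      left  : ∀ {γ γ₁ γ₂} → Reachable γ → step γ ≡ branch γ₁ γ₂ → Reachable γ₁
      right : ∀ {γ γ₁ γ₂} → Reachable γ → step γ ≡ branch γ₁ γ₂ → Reachable γ₂

    -- The tree of all executions from an outcome on.  Being inductive, it
    -- witnesses termination for every sequence of coin tosses.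
    data Run : Outcome → Set c where
      halt     : ∀ S → Run (halt S)
      continue : ∀ {γ} → Run (step γ) → Run (continue γ)
      branch   : ∀ {γ₁ γ₂} → Run (step γ₁) → Run (step γ₂) → Run (branch γ₁ γ₂)

    expectedValue : ∀ {o} → Run o → Carrier
    expectedValue (halt S)     = f S
    expectedValue (continue r) = expectedValue r
    expectedValue (branch r s) = (expectedValue r + expectedValue s) ÷ fromℕ 2

    storedElements : Configuration → ℕ
    storedElements γ = length (Configuration.elements γ)

    -- An element identifier takes 1 + ⌊log₂ n⌋ bits.  A number is charged one
    -- unit, as usual in the value oracle model.
    memory : Configuration → ℕ
    memory γ = length (code (Configuration.state γ))
         ℕ.+ storedElements γ ℕ.* suc ⌊log₂ n ⌋
         ℕ.+ length (Configuration.numbers γ)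

  IsSemiStreaming : Carrier → Machine → Set (c ⊔ ℓ₂)
  IsSemiStreaming ε M = ∃[ a ] ∃[ d ] ((I : Instance ε) →
    let open Instance I
        open Execution M I
    in
    ∀ γ → Reachable γ →
    memory γ ℕ.≤ a ℕ.* (k ℕ.* (1 ℕ.+ ⌊log₂ k ⌋ ℕ.+ ⌊log₂ n ⌋) ℕ.^ d))

  IsApproximation : Carrier → Carrier → Machine → Set (c ⊔ ℓ₂)
  IsApproximation β ε M = (I : Instance ε) →
    let open Instance I
        open Execution M I
    in
    (∀ γ S → Reachable γ → step γ ≡ halt S → ∣ S ∣ ℕ.≤ k) ×
    (∃[ r ] f OPT ÷ β ≤ expectedValue {step initial} r)

  StoresAtMost : (ℕ → Carrier) → Carrier → Machine → Set (c ⊔ ℓ₂)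
  StoresAtMost bound ε M = (I : Instance ε) →
    let open Instance I
        open Execution M I
    in
    ∀ γ → Reachable γ → fromℕ (storedElements γ) ≤ bound k

{-# OPTIONS --safe #-}
module Submission where

-- With m ≥ 12/ε and p = m + 2, keep p disjoint sets S_i of stored elements and
-- put an arriving u into some S_i with f(S_i + u) - f(S_i) ≥ τ/(3k).  If an S_i
-- reaches size k, then f(S_i) ≥ τ/3 and it is output.  Otherwise let A be the
-- union of the S_i.  Elements of OPT \ A have small marginals, so
--   f(OPT ∪ S_i) ≤ f(S_i) + f(OPT ∩ A) + τ/3   for every i,
-- while disjointness and submodularity give Σ_i f(OPT ∪ S_i) ≥ (p - 1) f(OPT).
-- Hence OPT ∩ A or some S_i has value at least (1/3 - 1/(2p)) τ, and since A has
-- only O(k/ε) elements, a set of at most k elements of A with this value is found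
-- by exhaustive search.  All tests are cleared of denominators: the final one is
-- (2m + 1) τ ≤ 6p f(T).

open import Defs
open import Algebra.Bundles using (RawRing)
import Algebra.Properties.CommutativeSemigroup as CommutativeSemigroup
import Algebra.Properties.IdempotentCommutativeMonoid as IdempotentCommutativeMonoid
import Algebra.Properties.Ring as RingProperties
import Algebra.Properties.Semiring.Mult as Mult
import Algebra.Solver.Ring as RingSolver
open import Algebra.Solver.Ring.AlmostCommutativeRing using (_-Raw-AlmostCommutative⟶_; fromCommutativeSemiring)
open import Data.Bool.Base using (Bool; true; false; if_then_else_; T)
open import Data.Fin.Base using (Fin; zero; suc)
open import Data.Fin.Subset using (Subset; ⊥; ⁅_⁆; _∪_; _∩_; ∁; ∣_∣; _∈_; _∉_; _⊆_; inside; outside)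
open import Data.Fin.Subset.Properties
open import Data.List.Base using (List; []; _∷_; length; map; head; drop)
import Data.List.Membership.Propositional as List
import Data.List.Membership.Propositional.Properties as List
open import Data.List.Properties using (length-map; ∷-injectiveʳ)
open import Data.List.Relation.Binary.Permutation.Propositional using (↭-sym; ↭⇒↭ₛ)
open import Data.List.Relation.Binary.Permutation.Propositional.Properties using (∈-resp-↭)
import Data.List.Relation.Binary.Permutation.Setoid.Properties as Permutation
open import Data.List.Relation.Unary.All as All using (All; []; _∷_)
open import Data.List.Relation.Unary.AllPairs using ([]; _∷_)
open import Data.List.Relation.Unary.Any using (here; there)
open import Data.List.Relation.Unary.Unique.Propositional using (Unique)
import Data.List.Relation.Unary.Unique.Propositional.Properties as Unique
open import Data.Maybe.Base as Maybe using (Maybe; just; nothing; maybe′)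
open import Data.Maybe.Properties using (just-injective)
import Data.Nat.Base as ℕ
open import Data.Nat.Base using (ℕ; zero; suc; _≡ᵇ_; _<ᵇ_; _≤ᵇ_; z≤n; s≤s)
open import Data.Nat.Logarithm using (⌊log₂_⌋)
import Data.Nat.Properties as ℕ
open import Data.Nat.Tactic.RingSolver using (solve-∀)
open import Data.Product.Base using (Σ-syntax; ∃-syntax; _×_; _,_; proj₁; proj₂)
open import Data.Sum.Base using (_⊎_; inj₁; inj₂; [_,_]′)
open import Data.Vec.Base using ([]; _∷_) renaming (here to hereᵥ; there to thereᵥ)
open import Function.Base using (_∘_; id)
open import Function.Definitions using (Injective)
open import Level using (_⊔_)
open import Relation.Binary.Bundles using (Poset)
open import Relation.Binary.Consequences using (dec⇒weaklyDec)
open import Relation.Binary.PropositionalEquality as ≡ using (_≡_; _≢_)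
import Relation.Binary.Reasoning.PartialOrder as PosetReasoning
open import Relation.Binary.Structures using (IsDecTotalOrder)
open import Relation.Nullary.Decidable.Core using (Dec; yes; no; does)
open import Relation.Nullary.Negation.Core using (¬_; contradiction)

-- Without monotonicity a single greedy set can spoil `OPT`: `f (OPT ∪ S)` may be far below `f OPT`.
-- Disjoint sets cannot all do so, because their losses add up to at most one `f OPT`; some set
-- loses at most a fraction `1/p`. For it `f S_i + f (OPT ∩ A) ≥ (1 - 1/p - 1/3) τ`, and one summand
-- is at least half of that, `(2p - 3) τ / (6p)`. With `p = m + 2` the number `2p - 3` is `2m + 1`,
-- free of truncated subtraction. The finite number of sets and the inexact estimate each cost at
-- most a factor `1 - ε/8`, and `(1 - ε/8)² / 3 ≥ 1 / (3 + ε)`. The set `OPT ∩ A` cannot be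
-- recognised by the machine, and an approximate choice from `A` would lose a further factor.
-- Exhaustive search loses nothing and fits the memory, since a candidate is a mask of `O(k/ε)`
-- bits. No coin is tossed, so each input has one execution. Termination, memory, feasibility and
-- value are all proved by one induction along it, and each part of the theorem is read off from
-- that.

module OrderedFieldProperties {c ℓ₁ ℓ₂} (K : ArchimedeanOrderedField c ℓ₁ ℓ₂) where
  open ArchimedeanOrderedField K
  open IsDecTotalOrder isDecTotalOrder public
    using () renaming
      ( refl to ≤-refl; reflexive to ≤-reflexive; trans to ≤-trans
      ; antisym to ≤-antisym; total to ≤-total )
  open Mult semiring using (×-homo-+; ×1-homo-*)
  open RingProperties ring using (-1*x≈-x; -‿involutive)

  ≤-poset : Poset c ℓ₁ ℓ₂
  ≤-poset = record { isPartialOrder = IsDecTotalOrder.isPartialOrder isDecTotalOrder }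

  open PosetReasoning ≤-poset

  module Solver where
    -- The negation is a dummy, matching that of `fromCommutativeSemiring`; the solver therefore
    -- treats only identities without subtraction, and differences are removed beforehand with
    -- `x-y+y≈x`.
    ℕ-rawRing : RawRing _ _
    ℕ-rawRing = record
      { Carrier = ℕ ; _≈_ = _≡_ ; _+_ = ℕ._+_ ; _*_ = ℕ._*_ ; -_ = id ; 0# = 0 ; 1# = 1 }

    fromℕ-homomorphism : ℕ-rawRing -Raw-AlmostCommutative⟶ fromCommutativeSemiring commutativeSemiring
    fromℕ-homomorphism = record
      { ⟦_⟧    = fromℕ
      ; +-homo = ×-homo-+ 1#
      ; *-homo = ×1-homo-*
      ; -‿homo = λ _ → refl
      ; 0-homo = refl
      ; 1-homo = +-identityʳ 1#
      }

    fromℕ-≟ : ∀ m n → Maybe (fromℕ m ≈ fromℕ n)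
    fromℕ-≟ m n = Maybe.map (λ { ≡.refl → refl }) (dec⇒weaklyDec ℕ._≟_ m n)

    open RingSolver ℕ-rawRing (fromCommutativeSemiring commutativeSemiring) fromℕ-homomorphism fromℕ-≟ public
      using (solve; con; _:=_; _:+_; _:*_)

  open Solver

  -- Arithmetic and order in an Archimedean ordered field.

  fromℕ-+ : ∀ m n → fromℕ (m ℕ.+ n) ≈ fromℕ m + fromℕ n
  fromℕ-+ = ×-homo-+ 1#

  fromℕ-* : ∀ m n → fromℕ (m ℕ.* n) ≈ fromℕ m * fromℕ n
  fromℕ-* = ×1-homo-*

  fromℕ-suc-* : ∀ m x → fromℕ (suc m) * x ≈ x + fromℕ m * x
  fromℕ-suc-* m x = trans (distribʳ x 1# (fromℕ m)) (+-congʳ (*-identityˡ x))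

  x-y+y≈x : ∀ x y → (x - y) + y ≈ x
  x-y+y≈x x y = trans (+-assoc x (- y) y) (trans (+-congˡ (-‿inverseˡ y)) (+-identityʳ x))

  +-mono-≤ : ∀ {x y u v} → x ≤ y → u ≤ v → x + u ≤ y + v
  +-mono-≤ {x} {y} {u} {v} x≤y u≤v = begin
    x + u ≤⟨ +-monoˡ-≤ u x≤y ⟩
    y + u ≈⟨ +-comm y u ⟩
    u + y ≤⟨ +-monoˡ-≤ y u≤v ⟩
    v + y ≈⟨ +-comm v y ⟩
    y + v ∎

  +-monoʳ-≤ : ∀ x {u v} → u ≤ v → x + u ≤ x + v
  +-monoʳ-≤ x = +-mono-≤ ≤-refl

  +-cancelʳ-≤ : ∀ z {x y} → x + z ≤ y + z → x ≤ y
  +-cancelʳ-≤ z {x} {y} le = begin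
    x               ≈⟨ cancel x ⟨
    (x + z) + - z   ≤⟨ +-monoˡ-≤ (- z) le ⟩
    (y + z) + - z   ≈⟨ cancel y ⟩
    y               ∎
    where
    cancel : ∀ w → (w + z) + - z ≈ w
    cancel w = trans (+-assoc w z (- z)) (trans (+-congˡ (-‿inverseʳ z)) (+-identityʳ w))

  +-cancelˡ-≤ : ∀ z {x y} → z + x ≤ z + y → x ≤ y
  +-cancelˡ-≤ z {x} {y} le = +-cancelʳ-≤ z (begin
    x + z ≈⟨ +-comm x z ⟩
    z + x ≤⟨ le ⟩
    z + y ≈⟨ +-comm z y ⟩
    y + z ∎)

  x≤x+y : ∀ x {y} → 0# ≤ y → x ≤ x + y
  x≤x+y x {y} 0≤y = begin
    x      ≈⟨ +-identityʳ x ⟨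
    x + 0# ≤⟨ +-monoʳ-≤ x 0≤y ⟩
    x + y  ∎

  ≰⇒≥ : ∀ {x y} → ¬ x ≤ y → y ≤ x
  ≰⇒≥ {x} {y} x≰y with ≤-total x y
  ... | inj₁ x≤y = contradiction x≤y x≰y
  ... | inj₂ y≤x = y≤x

  -- Averaging for two terms: if `u ≤ x`, then `x` may be lowered to `u` and cancelled. Cancellation
  -- of numerals, the pigeonhole and the choice between `OPT ∩ A` and some `S_i` all reduce to it.
  +-≤-split : ∀ {x y u v} → x + y ≤ u + v → x ≤ u ⊎ y ≤ v
  +-≤-split {x} {y} {u} {v} le with ≤-total x u
  ... | inj₁ x≤u = inj₁ x≤u
  ... | inj₂ u≤x = inj₂ (+-cancelˡ-≤ u (≤-trans (+-monoˡ-≤ y u≤x) le))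

  x≤y⇒0≤y-x : ∀ {x y} → x ≤ y → 0# ≤ y - x
  x≤y⇒0≤y-x {x} {y} x≤y = +-cancelʳ-≤ x (begin
    0# + x      ≈⟨ +-identityˡ x ⟩
    x           ≤⟨ x≤y ⟩
    y           ≈⟨ x-y+y≈x y x ⟨
    (y - x) + x ∎)

  *-monoʳ-≤ : ∀ {z} → 0# ≤ z → ∀ {x y} → x ≤ y → z * x ≤ z * y
  *-monoʳ-≤ {z} 0≤z {x} {y} x≤y = begin
    z * x                 ≈⟨ +-identityˡ (z * x) ⟨
    0# + z * x            ≤⟨ +-monoˡ-≤ (z * x) (*-nonNegative 0≤z (x≤y⇒0≤y-x x≤y)) ⟩
    z * (y - x) + z * x   ≈⟨ distribˡ z (y - x) x ⟨
    z * ((y - x) + x)     ≈⟨ *-congˡ (x-y+y≈x y x) ⟩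
    z * y                 ∎

  *-monoˡ-≤ : ∀ {z} → 0# ≤ z → ∀ {x y} → x ≤ y → x * z ≤ y * z
  *-monoˡ-≤ {z} 0≤z {x} {y} x≤y = begin
    x * z ≈⟨ *-comm x z ⟩
    z * x ≤⟨ *-monoʳ-≤ 0≤z x≤y ⟩
    z * y ≈⟨ *-comm z y ⟩
    y * z ∎

  0≤1 : 0# ≤ 1#
  0≤1 with ≤-total 0# 1#
  ... | inj₁ 0≤1 = 0≤1
  ... | inj₂ 1≤0 = begin
    0#            ≤⟨ *-nonNegative 0≤-1 0≤-1 ⟩
    - 1# * - 1#   ≈⟨ -1*x≈-x (- 1#) ⟩
    - - 1#        ≈⟨ -‿involutive 1# ⟩
    1#            ∎
    where
    0≤-1 : 0# ≤ - 1#
    0≤-1 = ≤-trans (x≤y⇒0≤y-x 1≤0) (≤-reflexive (+-identityˡ (- 1#)))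

  1≰0 : ¬ 1# ≤ 0#
  1≰0 1≤0 = 0≉1 (≤-antisym 0≤1 1≤0)

  0≤fromℕ : ∀ n → 0# ≤ fromℕ n
  0≤fromℕ zero    = ≤-refl
  0≤fromℕ (suc n) = ≤-trans 0≤1 (x≤x+y 1# (0≤fromℕ n))

  fromℕ-mono-≤ : ∀ {m n} → m ℕ.≤ n → fromℕ m ≤ fromℕ n
  fromℕ-mono-≤ {n = n} ℕ.z≤n = 0≤fromℕ n
  fromℕ-mono-≤ (ℕ.s≤s m≤n) = +-monoʳ-≤ 1# (fromℕ-mono-≤ m≤n)

  fromℕ-suc≉0 : ∀ n → ¬ fromℕ (suc n) ≈ 0#
  fromℕ-suc≉0 n eq = 1≰0 (≤-trans (x≤x+y 1# (0≤fromℕ n)) (≤-reflexive eq))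

  fromℕ-cancelˡ-≤ : ∀ n {x y} → fromℕ (suc n) * x ≤ fromℕ (suc n) * y → x ≤ y
  fromℕ-cancelˡ-≤ zero {x} {y} le = begin
    x             ≈⟨ solve 1 (λ x → x := con 1 :* x) refl x ⟩
    fromℕ 1 * x   ≤⟨ le ⟩
    fromℕ 1 * y   ≈⟨ solve 1 (λ x → con 1 :* x := x) refl y ⟩
    y             ∎
  fromℕ-cancelˡ-≤ (suc n) {x} {y} le
    with +-≤-split {x} {fromℕ (suc n) * x} {y} {fromℕ (suc n) * y} (begin
      x + fromℕ (suc n) * x   ≈⟨ fromℕ-suc-* (suc n) x ⟨
      fromℕ (2 ℕ.+ n) * x     ≤⟨ le ⟩
      fromℕ (2 ℕ.+ n) * y     ≈⟨ fromℕ-suc-* (suc n) y ⟩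
      y + fromℕ (suc n) * y   ∎)
  ... | inj₁ x≤y = x≤y
  ... | inj₂ le′ = fromℕ-cancelˡ-≤ n le′

  ⁻¹-nonNegative : ∀ {x} → 0# ≤ x → ¬ x ≈ 0# → 0# ≤ x ⁻¹
  ⁻¹-nonNegative {x} 0≤x x≉0 with ≤-total 0# (x ⁻¹)
  ... | inj₁ 0≤x⁻¹ = 0≤x⁻¹
  ... | inj₂ x⁻¹≤0 = contradiction (begin
    1#          ≈⟨ *-inverseʳ x≉0 ⟨
    x * x ⁻¹    ≤⟨ *-monoʳ-≤ 0≤x x⁻¹≤0 ⟩
    x * 0#      ≈⟨ zeroʳ x ⟩
    0#          ∎) 1≰0

  x≤y*z⇒x÷y≤z : ∀ {x y z} → 0# ≤ y → ¬ y ≈ 0# → x ≤ y * z → x ÷ y ≤ z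
  x≤y*z⇒x÷y≤z {x} {y} {z} 0≤y y≉0 le = begin
    x * y ⁻¹         ≤⟨ *-monoˡ-≤ (⁻¹-nonNegative 0≤y y≉0) le ⟩
    y * z * y ⁻¹     ≈⟨ solve 3 (λ y z w → y :* z :* w := (y :* w) :* z) refl y z (y ⁻¹) ⟩
    y * y ⁻¹ * z     ≈⟨ *-congʳ (*-inverseʳ y≉0) ⟩
    1# * z           ≈⟨ *-identityˡ z ⟩
    z                ∎

  -- The Archimedean axiom gives an upper bound of unknown quality. Descending from it ends within 1
  -- of `x`, which is what ties the number of sets to `ε ⁻¹` in the storage bound.
  ceiling : ∀ {x} → 0# ≤ x → ∃[ n ] (x ≤ fromℕ n × fromℕ n ≤ x + 1#)
  ceiling {x} 0≤x = let n , x≤n = archimedean x in search n x≤n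
    where
    search : ∀ n → x ≤ fromℕ n → ∃[ n ] (x ≤ fromℕ n × fromℕ n ≤ x + 1#)
    search zero    x≤0  = 0 , x≤0 , ≤-trans 0≤x (x≤x+y x 0≤1)
    search (suc n) x≤1+n with ≤-total x (fromℕ n)
    ... | inj₁ x≤n = search n x≤n
    ... | inj₂ n≤x = suc n , x≤1+n , (begin
      1# + fromℕ n ≈⟨ +-comm 1# (fromℕ n) ⟩
      fromℕ n + 1# ≤⟨ +-monoˡ-≤ 1# n≤x ⟩
      x + 1#       ∎)

  -- With w = 8 - ε the hypotheses give w² x ≤ 192 z, and w² (3 + ε) ≥ 192; the
  -- latter is homogenised with ε + δ in place of 1 so as to have no subtraction.
  guarantee : ∀ {ε t x z} m → 0# ≤ ε → ε ≤ 1# → 0# ≤ x →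
    fromℕ 12 ≤ fromℕ m * ε → 0# ≤ t →
    (1# - ε ÷ fromℕ 8) * x ≤ t →
    fromℕ (2 ℕ.* m ℕ.+ 1) * t ≤ fromℕ (6 ℕ.* (2 ℕ.+ m)) * z →
    x ≤ (fromℕ 3 + ε) * z
  guarantee {ε} {t} {x} {z} m 0≤ε ε≤1 0≤x 12≤mε 0≤t lower value =
    fromℕ-cancelˡ-≤ 191 (begin
      fromℕ 192 * x
        ≈⟨ solve 1 (λ x → con 192 :* x := con 192 :* (con 1 :* con 1 :* con 1) :* x) refl x ⟩
      fromℕ 192 * (fromℕ 1 * fromℕ 1 * fromℕ 1) * x
        ≈⟨ *-congʳ (*-congˡ (*-cong (*-cong unit unit) unit)) ⟨
      fromℕ 192 * ((ε + δ) * (ε + δ) * (ε + δ)) * x ≤⟨ x≤x+y _ (*-nonNegative excess≥0 0≤x) ⟩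
      fromℕ 192 * ((ε + δ) * (ε + δ) * (ε + δ)) * x + excess * x ≈⟨ solve 3 (λ ε δ x →
          con 192 :* ((ε :+ δ) :* (ε :+ δ) :* (ε :+ δ)) :* x
          :+ (con 4 :* (ε :* ε :* ε) :+ con 19 :* (ε :* ε :* δ) :+ con 16 :* (ε :* δ :* δ)) :* x
          := (con 3 :* (ε :+ δ) :+ ε) :* ((con 7 :* ε :+ con 8 :* δ) :* ((con 7 :* ε :+ con 8 :* δ) :* x)))
          refl ε δ x ⟩
      (fromℕ 3 * (ε + δ) + ε) * (w * (w * x)) ≤⟨ *-monoʳ-≤ 0≤3u+ε w²x≤192z ⟩
      (fromℕ 3 * (ε + δ) + ε) * (fromℕ 192 * z) ≈⟨ *-congʳ (+-congʳ (*-congˡ unit)) ⟩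
      (fromℕ 3 * fromℕ 1 + ε) * (fromℕ 192 * z)
        ≈⟨ solve 2 (λ ε z → (con 3 :* con 1 :+ ε) :* (con 192 :* z) := con 192 :* ((con 3 :+ ε) :* z)) refl ε z ⟩
      fromℕ 192 * ((fromℕ 3 + ε) * z) ∎)
    where
    δ w excess : Carrier
    δ = 1# - ε
    w = fromℕ 7 * ε + fromℕ 8 * δ
    -- This is `w² (3 + ε) - 192 = 16 ε - 13 ε² + ε³`, made homogeneous of degree 3; in `ε` and `δ`
    -- all its coefficients are non-negative.
    excess = fromℕ 4 * (ε * ε * ε) + fromℕ 19 * (ε * ε * δ) + fromℕ 16 * (ε * δ * δ)

    0≤δ : 0# ≤ δ
    0≤δ = x≤y⇒0≤y-x ε≤1

    infixl 6 _⊕_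
    _⊕_ : ∀ {x y} → 0# ≤ x → 0# ≤ y → 0# ≤ x + y
    _⊕_ {x} 0≤x 0≤y = ≤-trans 0≤x (x≤x+y x 0≤y)

    infixl 7 _⊛_
    _⊛_ : ∀ {x y} → 0# ≤ x → 0# ≤ y → 0# ≤ x * y
    _⊛_ = *-nonNegative

    excess≥0 : 0# ≤ excess
    excess≥0 = 0≤fromℕ 4 ⊛ (0≤ε ⊛ 0≤ε ⊛ 0≤ε) ⊕ 0≤fromℕ 19 ⊛ (0≤ε ⊛ 0≤ε ⊛ 0≤δ) ⊕ 0≤fromℕ 16 ⊛ (0≤ε ⊛ 0≤δ ⊛ 0≤δ)

    0≤w : 0# ≤ w
    0≤w = 0≤fromℕ 7 ⊛ 0≤ε ⊕ 0≤fromℕ 8 ⊛ 0≤δ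

    ε+δ≈1 : ε + δ ≈ 1#
    ε+δ≈1 = trans (+-comm ε δ) (x-y+y≈x 1# ε)

    unit : ε + δ ≈ fromℕ 1
    unit = trans ε+δ≈1 (sym (+-identityʳ 1#))

    0≤3u+ε : 0# ≤ fromℕ 3 * (ε + δ) + ε
    0≤3u+ε = 0≤fromℕ 3 ⊛ (0≤ε ⊕ 0≤δ) ⊕ 0≤ε

    w+ε : ∀ y → w * y + ε * y ≈ fromℕ 8 * y
    w+ε y = begin-equality
      w * y + ε * y
        ≈⟨ solve 3 (λ ε δ y → (con 7 :* ε :+ con 8 :* δ) :* y :+ ε :* y := con 8 :* (ε :+ δ) :* y) refl ε δ y ⟩
      fromℕ 8 * (ε + δ) * y          ≈⟨ *-congʳ (*-congˡ ε+δ≈1) ⟩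
      fromℕ 8 * 1# * y               ≈⟨ *-congʳ (*-identityʳ (fromℕ 8)) ⟩
      fromℕ 8 * y                    ∎

    8[ε÷8]≈ε : fromℕ 8 * (ε ÷ fromℕ 8) ≈ ε
    8[ε÷8]≈ε = begin-equality
      fromℕ 8 * (ε * fromℕ 8 ⁻¹)
        ≈⟨ solve 3 (λ a b c → a :* (b :* c) := b :* (a :* c)) refl (fromℕ 8) ε (fromℕ 8 ⁻¹) ⟩
      ε * (fromℕ 8 * fromℕ 8 ⁻¹)   ≈⟨ *-congˡ (*-inverseʳ (fromℕ-suc≉0 7)) ⟩
      ε * 1#                       ≈⟨ *-identityʳ ε ⟩
      ε                            ∎

    wx≤8t : w * x ≤ fromℕ 8 * t
    wx≤8t = begin
      w * x ≈⟨ *-congʳ w≈ ⟩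
      fromℕ 8 * (1# - ε ÷ fromℕ 8) * x ≈⟨ *-assoc _ _ _ ⟩
      fromℕ 8 * ((1# - ε ÷ fromℕ 8) * x) ≤⟨ *-monoʳ-≤ (0≤fromℕ 8) lower ⟩
      fromℕ 8 * t ∎
      where
      w≈ : w ≈ fromℕ 8 * (1# - ε ÷ fromℕ 8)
      w≈ = ≤-antisym (+-cancelʳ-≤ ε (≤-reflexive sum≈)) (+-cancelʳ-≤ ε (≤-reflexive (sym sum≈)))
        where
        sum≈ : w + ε ≈ fromℕ 8 * (1# - ε ÷ fromℕ 8) + ε
        sum≈ = begin-equality
          w + ε ≈⟨ +-cong (*-identityʳ w) (*-identityʳ ε) ⟨
          w * 1# + ε * 1# ≈⟨ w+ε 1# ⟩
          fromℕ 8 * 1# ≈⟨ *-congˡ (x-y+y≈x 1# (ε ÷ fromℕ 8)) ⟨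
          fromℕ 8 * ((1# - ε ÷ fromℕ 8) + ε ÷ fromℕ 8) ≈⟨ distribˡ _ _ _ ⟩
          fromℕ 8 * (1# - ε ÷ fromℕ 8) + fromℕ 8 * (ε ÷ fromℕ 8) ≈⟨ +-congˡ 8[ε÷8]≈ε ⟩
          fromℕ 8 * (1# - ε ÷ fromℕ 8) + ε ∎

    p≈ : fromℕ (2 ℕ.+ m) ≈ fromℕ 2 + fromℕ m
    p≈ = fromℕ-+ 2 m

    12t≤pεt : fromℕ 12 * t ≤ fromℕ (2 ℕ.+ m) * (ε * t)
    12t≤pεt = begin
      fromℕ 12 * t                      ≤⟨ *-monoˡ-≤ 0≤t 12≤mε ⟩
      fromℕ m * ε * t                   ≈⟨ *-assoc _ _ _ ⟩
      fromℕ m * (ε * t)                 ≤⟨ *-monoˡ-≤ (0≤ε ⊛ 0≤t) (fromℕ-mono-≤ (ℕ.m≤n+m m 2)) ⟩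
      fromℕ (2 ℕ.+ m) * (ε * t)         ∎

    8t≤24z+εt : fromℕ 8 * t ≤ fromℕ 24 * z + ε * t
    8t≤24z+εt = fromℕ-cancelˡ-≤ (suc m) (begin
      p * (fromℕ 8 * t) ≈⟨ *-congʳ p≈ ⟩
      -- `8 p = 4 (2 m + 1) + 12`: the remainder 12 is the origin of the condition `12 ≤ m ε`, which
      -- turns the loss from having finitely many sets into `ε t`.
      (fromℕ 2 + fromℕ m) * (fromℕ 8 * t)
        ≈⟨ solve 2 (λ m t → (con 2 :+ m) :* (con 8 :* t) := con 4 :* ((con 2 :* m :+ con 1) :* t) :+ con 12 :* t) refl (fromℕ m) t ⟩
      fromℕ 4 * ((fromℕ 2 * fromℕ m + fromℕ 1) * t) + fromℕ 12 * t
        ≈⟨ +-congʳ (*-congˡ (*-congʳ (trans (fromℕ-+ (2 ℕ.* m) 1) (+-congʳ (fromℕ-* 2 m))))) ⟨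
      fromℕ 4 * (fromℕ (2 ℕ.* m ℕ.+ 1) * t) + fromℕ 12 * t
        ≤⟨ +-mono-≤ (*-monoʳ-≤ (0≤fromℕ 4) value) 12t≤pεt ⟩
      fromℕ 4 * (fromℕ (6 ℕ.* (2 ℕ.+ m)) * z) + p * (ε * t)
        ≈⟨ +-congʳ (*-congˡ (*-congʳ (fromℕ-* 6 (2 ℕ.+ m)))) ⟩
      fromℕ 4 * (fromℕ 6 * p * z) + p * (ε * t)
        ≈⟨ solve 4 (λ p z ε t → con 4 :* (con 6 :* p :* z) :+ p :* (ε :* t) := p :* (con 24 :* z :+ ε :* t)) refl p z ε t ⟩
      p * (fromℕ 24 * z + ε * t) ∎)
      where
      p : Carrier
      p = fromℕ (2 ℕ.+ m)

    wt≤24z : w * t ≤ fromℕ 24 * z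
    wt≤24z = +-cancelʳ-≤ (ε * t) (≤-trans (≤-reflexive (w+ε t)) 8t≤24z+εt)

    w²x≤192z : w * (w * x) ≤ fromℕ 192 * z
    w²x≤192z = begin
      w * (w * x) ≤⟨ *-monoʳ-≤ 0≤w wx≤8t ⟩
      w * (fromℕ 8 * t) ≈⟨ solve 2 (λ w t → w :* (con 8 :* t) := con 8 :* (w :* t)) refl w t ⟩
      fromℕ 8 * (w * t) ≤⟨ *-monoʳ-≤ (0≤fromℕ 8) wt≤24z ⟩
      fromℕ 8 * (fromℕ 24 * z) ≈⟨ solve 1 (λ z → con 8 :* (con 24 :* z) := con 192 :* z) refl z ⟩
      fromℕ 192 * z ∎

-- Finite subsets.

∣⁅x⁆∪p∣≤1+∣p∣ : ∀ {n} (x : Fin n) p → ∣ ⁅ x ⁆ ∪ p ∣ ℕ.≤ suc ∣ p ∣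
∣⁅x⁆∪p∣≤1+∣p∣ zero    (b ∷ p) rewrite ∪-identityˡ p = ℕ.s≤s (∣p∣≤∣x∷p∣ b p)
∣⁅x⁆∪p∣≤1+∣p∣ (suc x) (true  ∷ p) = ℕ.s≤s (∣⁅x⁆∪p∣≤1+∣p∣ x p)
∣⁅x⁆∪p∣≤1+∣p∣ (suc x) (false ∷ p) = ∣⁅x⁆∪p∣≤1+∣p∣ x p

x∉p⇒∣⁅x⁆∪p∣≡1+∣p∣ : ∀ {n} {x : Fin n} {p} → x ∉ p → ∣ ⁅ x ⁆ ∪ p ∣ ≡ suc ∣ p ∣
x∉p⇒∣⁅x⁆∪p∣≡1+∣p∣ {x = zero}  {true  ∷ p} x∉p = contradiction hereᵥ x∉p
x∉p⇒∣⁅x⁆∪p∣≡1+∣p∣ {x = zero}  {false ∷ p} x∉p rewrite ∪-identityˡ p = ≡.refl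
x∉p⇒∣⁅x⁆∪p∣≡1+∣p∣ {x = suc x} {true  ∷ p} x∉p = ≡.cong suc (x∉p⇒∣⁅x⁆∪p∣≡1+∣p∣ (x∉p ∘ thereᵥ))
x∉p⇒∣⁅x⁆∪p∣≡1+∣p∣ {x = suc x} {false ∷ p} x∉p = x∉p⇒∣⁅x⁆∪p∣≡1+∣p∣ (x∉p ∘ thereᵥ)

x∈⁅x⁆∪p : ∀ {n} (x : Fin n) p → x ∈ ⁅ x ⁆ ∪ p
x∈⁅x⁆∪p x p = x∈p∪q⁺ (inj₁ (x∈⁅x⁆ x))

x∈p⇒⁅x⁆∪p≡p : ∀ {n} {x : Fin n} {p} → x ∈ p → ⁅ x ⁆ ∪ p ≡ p
x∈p⇒⁅x⁆∪p≡p {x = x} {p} x∈p = ⊆-antisym to (q⊆p∪q ⁅ x ⁆ p)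
  where
  to : ⁅ x ⁆ ∪ p ⊆ p
  to y∈ with x∈p∪q⁻ ⁅ x ⁆ p y∈
  ... | inj₁ y∈⁅x⁆ rewrite x∈⁅y⁆⇒x≡y x y∈⁅x⁆ = x∈p
  ... | inj₂ y∈p = y∈p

x∉p⇒[⁅x⁆∪q]∩p≡q : ∀ {n} {x : Fin n} {p q} → q ⊆ p → x ∉ p → (⁅ x ⁆ ∪ q) ∩ p ≡ q
x∉p⇒[⁅x⁆∪q]∩p≡q {x = x} {p} {q} q⊆p x∉p = ⊆-antisym to (λ y∈q → x∈p∩q⁺ (q⊆p∪q ⁅ x ⁆ q y∈q , q⊆p y∈q))
  where
  to : (⁅ x ⁆ ∪ q) ∩ p ⊆ q
  to y∈ with x∈p∩q⁻ (⁅ x ⁆ ∪ q) p y∈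
  ... | y∈∪ , y∈p with x∈p∪q⁻ ⁅ x ⁆ q y∈∪
  ...   | inj₁ y∈⁅x⁆ rewrite x∈⁅y⁆⇒x≡y x y∈⁅x⁆ = contradiction y∈p x∉p
  ...   | inj₂ y∈q = y∈q

q⊆p⇒[⁅x⁆∪q]∪p≡⁅x⁆∪p : ∀ {n} {x : Fin n} {p q} → q ⊆ p → (⁅ x ⁆ ∪ q) ∪ p ≡ ⁅ x ⁆ ∪ p
q⊆p⇒[⁅x⁆∪q]∪p≡⁅x⁆∪p {x = x} {p} {q} q⊆p = ≡.trans (∪-assoc ⁅ x ⁆ q p) (≡.cong (⁅ x ⁆ ∪_) q∪p≡p)
  where
  q∪p≡p : q ∪ p ≡ p
  q∪p≡p = ⊆-antisym ([ q⊆p , id ]′ ∘ x∈p∪q⁻ q p) (q⊆p∪q q p)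

q∪[p∩r]∪[p∩∁r]≡p∪q : ∀ {n} (p q r : Subset n) → (q ∪ (p ∩ r)) ∪ (p ∩ ∁ r) ≡ p ∪ q
q∪[p∩r]∪[p∩∁r]≡p∪q {n} p q r = begin
  (q ∪ (p ∩ r)) ∪ (p ∩ ∁ r)   ≡⟨ ∪-assoc q _ _ ⟩
  q ∪ ((p ∩ r) ∪ (p ∩ ∁ r))   ≡⟨ ≡.cong (q ∪_) (∩-distribˡ-∪ p r (∁ r)) ⟨
  q ∪ (p ∩ (r ∪ ∁ r))         ≡⟨ ≡.cong (λ s → q ∪ (p ∩ s)) (p∪∁p≡⊤ r) ⟩
  q ∪ (p ∩ _)                 ≡⟨ ≡.cong (q ∪_) (∩-identityʳ p) ⟩
  q ∪ p                       ≡⟨ ∪-comm q p ⟩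
  p ∪ q                       ∎
  where open ≡.≡-Reasoning

∣toSubset∣≤length : ∀ {n} (xs : List (Fin n)) → ∣ toSubset xs ∣ ℕ.≤ length xs
∣toSubset∣≤length {n} []       rewrite ∣⊥∣≡0 n = ℕ.z≤n
∣toSubset∣≤length     (x ∷ xs) =
  ℕ.≤-trans (∣⁅x⁆∪p∣≤1+∣p∣ x (toSubset xs)) (ℕ.s≤s (∣toSubset∣≤length xs))

toSubset-map-suc : ∀ {n} (xs : List (Fin n)) → toSubset (map suc xs) ≡ outside ∷ toSubset xs
toSubset-map-suc []       = ≡.refl
toSubset-map-suc (x ∷ xs) = ≡.cong (⁅ suc x ⁆ ∪_) (toSubset-map-suc xs)

enumerate : ∀ {n} (p : Subset n) → ∃[ xs ] (toSubset xs ≡ p × length xs ≡ ∣ p ∣)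
enumerate []            = [] , ≡.refl , ≡.refl
enumerate (true ∷ p)  with enumerate p
... | xs , ≡.refl , len = zero ∷ map suc xs ,
  ≡.trans (≡.cong (⁅ zero ⁆ ∪_) (toSubset-map-suc xs)) (≡.cong (inside ∷_) (∪-identityˡ (toSubset xs))) ,
  ≡.cong suc (≡.trans (length-map suc xs) len)
enumerate (false ∷ p) with enumerate p
... | xs , ≡.refl , len = map suc xs , toSubset-map-suc xs , ≡.trans (length-map suc xs) len

-- Submodular functions: small marginals and disjoint sets.

module _ {c ℓ₁ ℓ₂} (K : ArchimedeanOrderedField c ℓ₁ ℓ₂) where
  open ArchimedeanOrderedField K hiding (zero)
  open OrderedFieldProperties K
  open Solver
  open PosetReasoning ≤-poset

  ∑< : ℕ → (ℕ → Carrier) → Carrier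
  ∑< zero    a = 0#
  ∑< (suc m) a = a m + ∑< m a

  pigeonhole : ∀ m z b a → fromℕ (suc m) * b ≤ z * ∑< (suc m) a → ∃[ i ] (i ℕ.≤ m × b ≤ z * a i)
  pigeonhole m z b a le with +-≤-split (begin
    b + fromℕ m * b         ≈⟨ fromℕ-suc-* m b ⟨
    fromℕ (suc m) * b       ≤⟨ le ⟩
    z * (a m + ∑< m a)      ≈⟨ distribˡ z (a m) (∑< m a) ⟩
    z * a m + z * ∑< m a    ∎)
  pigeonhole m       z b a le | inj₁ b≤ = m , ℕ.≤-refl , b≤
  pigeonhole (suc m) z b a le | inj₂ le′ with pigeonhole m z b a le′
  ... | i , i≤m , b≤ = i , ℕ.m≤n⇒m≤1+n i≤m , b≤
  -- With no summand left the second alternative only says `0 ≤ 0`; the original inequality has a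
  -- single term and serves instead.
  pigeonhole zero    z b a le | inj₂ _ = 0 , ℕ.z≤n , (begin
    b               ≈⟨ solve 1 (λ b → b := con 1 :* b) refl b ⟩
    fromℕ 1 * b     ≤⟨ le ⟩
    z * (a 0 + 0#)  ≈⟨ *-congˡ (+-identityʳ (a 0)) ⟩
    z * a 0         ∎)

  module SubmodularFunction
    {n : ℕ} (f : Subset n → Carrier) (f≥0 : NonNegative K f) (f-sub : Submodular K f) where

    f-cong : ∀ {A B} → A ≡ B → f A ≈ f B
    f-cong ≡.refl = refl

    f-∪-≤ : ∀ A B → f (A ∪ B) ≤ f A + f B
    f-∪-≤ A B = ≤-trans (x≤x+y (f (A ∪ B)) (f≥0 (A ∩ B))) (f-sub A B)

    -- Stated for some S ⊆ B rather than for B, so that it persists when B grows.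
    SmallMarginal : Carrier → Carrier → Subset n → Fin n → Set ℓ₂
    SmallMarginal z t B x = ∃[ S ] (S ⊆ B × z * f (⁅ x ⁆ ∪ S) ≤ z * f S + t)

    module _ {z t : Carrier} (0≤z : 0# ≤ z) (0≤t : 0# ≤ t) where

      -- Diminishing returns from the lattice form of submodularity: for `x ∉ B` the sets
      -- `⁅ x ⁆ ∪ S` and `B` have union `⁅ x ⁆ ∪ B` and intersection `S`. For `x ∈ B` nothing
      -- changes and `0 ≤ t` suffices.
      f-insert-≤ : ∀ {B x} → SmallMarginal z t B x → z * f (⁅ x ⁆ ∪ B) ≤ z * f B + t
      f-insert-≤ {B} {x} (S , S⊆B , small) with x ∈? B
      ... | yes x∈B = begin
        z * f (⁅ x ⁆ ∪ B)  ≈⟨ *-congˡ (f-cong (x∈p⇒⁅x⁆∪p≡p x∈B)) ⟩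
        z * f B            ≤⟨ x≤x+y (z * f B) 0≤t ⟩
        z * f B + t        ∎
      ... | no x∉B = +-cancelʳ-≤ (z * f S) (begin
        z * f (⁅ x ⁆ ∪ B) + z * f S                          ≈⟨ distribˡ z _ _ ⟨
        z * (f (⁅ x ⁆ ∪ B) + f S)
          ≈⟨ *-congˡ (+-cong (f-cong (q⊆p⇒[⁅x⁆∪q]∪p≡⁅x⁆∪p S⊆B)) (f-cong (x∉p⇒[⁅x⁆∪q]∩p≡q S⊆B x∉B))) ⟨
        z * (f ((⁅ x ⁆ ∪ S) ∪ B) + f ((⁅ x ⁆ ∪ S) ∩ B))
          ≤⟨ *-monoʳ-≤ 0≤z (f-sub (⁅ x ⁆ ∪ S) B) ⟩
        z * (f (⁅ x ⁆ ∪ S) + f B)                            ≈⟨ distribˡ z _ _ ⟩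
        z * f (⁅ x ⁆ ∪ S) + z * f B                          ≤⟨ +-monoˡ-≤ (z * f B) small ⟩
        z * f S + t + z * f B
          ≈⟨ solve 3 (λ s t b → s :+ t :+ b := b :+ t :+ s) refl (z * f S) t (z * f B) ⟩
        z * f B + t + z * f S                                ∎)

      f-∪-toSubset-≤ : ∀ {B} xs → (∀ {x} → x ∈ toSubset xs → SmallMarginal z t B x) →
        z * f (B ∪ toSubset xs) ≤ z * f B + fromℕ (length xs) * t
      f-∪-toSubset-≤ {B} [] small = begin
        z * f (B ∪ ⊥)       ≈⟨ *-congˡ (f-cong (∪-identityʳ B)) ⟩
        z * f B             ≈⟨ +-identityʳ (z * f B) ⟨
        z * f B + 0#        ≈⟨ +-congˡ (zeroˡ t) ⟨
        z * f B + 0# * t    ∎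
      f-∪-toSubset-≤ {B} (x ∷ xs) small = begin
        z * f (B ∪ (⁅ x ⁆ ∪ R))                ≈⟨ *-congˡ (f-cong rearrange) ⟩
        z * f (⁅ x ⁆ ∪ (B ∪ R))                ≤⟨ f-insert-≤ (enlarge (small (x∈⁅x⁆∪p x R))) ⟩
        z * f (B ∪ R) + t
          ≤⟨ +-monoˡ-≤ t (f-∪-toSubset-≤ xs (small ∘ q⊆p∪q ⁅ x ⁆ R)) ⟩
        z * f B + fromℕ (length xs) * t + t
          ≈⟨ solve 3 (λ b l t → b :+ l :+ t := b :+ (t :+ l)) refl (z * f B) (fromℕ (length xs) * t) t ⟩
        z * f B + (t + fromℕ (length xs) * t)  ≈⟨ +-congˡ (fromℕ-suc-* (length xs) t) ⟨
        z * f B + fromℕ (suc (length xs)) * t  ∎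
        where
        R : Subset n
        R = toSubset xs
        rearrange : B ∪ (⁅ x ⁆ ∪ R) ≡ ⁅ x ⁆ ∪ (B ∪ R)
        rearrange = ≡.trans (≡.sym (∪-assoc B ⁅ x ⁆ R))
          (≡.trans (≡.cong (_∪ R) (∪-comm B ⁅ x ⁆)) (∪-assoc ⁅ x ⁆ B R))
        enlarge : SmallMarginal z t B x → SmallMarginal z t (B ∪ R) x
        enlarge (S , S⊆B , le) = S , p⊆p∪q R ∘ S⊆B , le

    module _ (S : ℕ → Subset n) where

      ⋃< : ℕ → Subset n
      ⋃< zero    = ⊥
      ⋃< (suc m) = ⋃< m ∪ S m

      x∈⋃<⁻ : ∀ m {x} → x ∈ ⋃< m → ∃[ i ] (i ℕ.< m × x ∈ S i)
      x∈⋃<⁻ zero    x∈ = contradiction x∈ ∉⊥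
      x∈⋃<⁻ (suc m) x∈ with x∈p∪q⁻ (⋃< m) (S m) x∈
      ... | inj₂ x∈S = m , ℕ.≤-refl , x∈S
      ... | inj₁ x∈⋃ with x∈⋃<⁻ m x∈⋃
      ...   | i , i<m , x∈S = i , ℕ.m≤n⇒m≤1+n i<m , x∈S

      module _ (disjoint : ∀ {i j x} → x ∈ S i → x ∈ S j → i ≡ j) (O : Subset n) where

        -- Adding the sets one at a time, submodularity gives
        -- f (O ∪ ⋃< m) + f (O ∪ S m) ≥ f (O ∪ ⋃< (suc m)) + f O.
        ∑-f-∪-≥ : ∀ m → fromℕ m * f O + f (O ∪ ⋃< m) ≤ f O + ∑< m (λ i → f (O ∪ S i))
        ∑-f-∪-≥ zero = begin
          0# * f O + f (O ∪ ⊥)   ≈⟨ +-cong (zeroˡ (f O)) (f-cong (∪-identityʳ O)) ⟩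
          0# + f O               ≈⟨ +-comm 0# (f O) ⟩
          f O + 0#               ∎
        ∑-f-∪-≥ (suc m) = begin
          fromℕ (suc m) * f O + f (O ∪ (U ∪ S m))           ≈⟨ +-congʳ (fromℕ-suc-* m (f O)) ⟩
          f O + fromℕ m * f O + f (O ∪ (U ∪ S m))
            ≈⟨ solve 3 (λ a b c → a :+ b :+ c := b :+ (c :+ a)) refl (f O) (fromℕ m * f O) _ ⟩
          fromℕ m * f O + (f (O ∪ (U ∪ S m)) + f O)
            ≈⟨ +-congˡ (+-cong (f-cong union) (f-cong intersection)) ⟨
          fromℕ m * f O + (f ((O ∪ U) ∪ (O ∪ S m)) + f ((O ∪ U) ∩ (O ∪ S m)))
            ≤⟨ +-monoʳ-≤ (fromℕ m * f O) (f-sub (O ∪ U) (O ∪ S m)) ⟩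
          fromℕ m * f O + (f (O ∪ U) + f (O ∪ S m))         ≈⟨ +-assoc _ _ _ ⟨
          fromℕ m * f O + f (O ∪ U) + f (O ∪ S m)           ≤⟨ +-monoˡ-≤ (f (O ∪ S m)) (∑-f-∪-≥ m) ⟩
          f O + ∑< m _ + f (O ∪ S m)
            ≈⟨ solve 3 (λ a b c → a :+ b :+ c := a :+ (c :+ b)) refl (f O) (∑< m (λ i → f (O ∪ S i))) (f (O ∪ S m)) ⟩
          f O + (f (O ∪ S m) + ∑< m _)                      ∎
          where
          U : Subset n
          U = ⋃< m
          union : (O ∪ U) ∪ (O ∪ S m) ≡ O ∪ (U ∪ S m)
          union = ≡.sym (IdempotentCommutativeMonoid.∙-distrˡ-∙ (∪-idempotentCommutativeMonoid n) O U (S m))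
          empty : U ∩ S m ≡ ⊥
          empty = Empty-unique λ { (x , x∈) →
            let x∈U , x∈S = x∈p∩q⁻ U (S m) x∈
                i , i<m , x∈Sᵢ = x∈⋃<⁻ m x∈U
            in ℕ.<⇒≢ i<m (disjoint x∈Sᵢ x∈S) }
          intersection : (O ∪ U) ∩ (O ∪ S m) ≡ O
          intersection = ≡.trans (≡.sym (∪-distribˡ-∩ O U (S m)))
            (≡.trans (≡.cong (O ∪_) empty) (∪-identityʳ O))

        -- Non-negativity allows the value of the full union to be dropped. One copy of `f O`
        -- cancels, so `suc m` sets yield only the factor `m`; this missing copy is the price of
        -- non-monotonicity.
        ∑-f-∪-≥′ : ∀ m → fromℕ m * f O ≤ ∑< (suc m) (λ i → f (O ∪ S i))
        ∑-f-∪-≥′ m = +-cancelˡ-≤ (f O) (begin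
          f O + fromℕ m * f O                         ≈⟨ fromℕ-suc-* m (f O) ⟨
          fromℕ (suc m) * f O                         ≤⟨ x≤x+y _ (f≥0 (O ∪ ⋃< (suc m))) ⟩
          fromℕ (suc m) * f O + f (O ∪ ⋃< (suc m))    ≤⟨ ∑-f-∪-≥ (suc m) ⟩
          f O + ∑< (suc m) _                          ∎)

        valuable-part : ∀ {k t} m W → 1 ℕ.≤ k → ∣ O ∣ ℕ.≤ k → (0≤t : 0# ≤ t) → t ≤ f O →
          (∀ {x i} → x ∉ W → i ℕ.< 2 ℕ.+ m → SmallMarginal (fromℕ (3 ℕ.* k)) t (S i) x) →
          (fromℕ (2 ℕ.* m ℕ.+ 1) * t ≤ fromℕ (6 ℕ.* (2 ℕ.+ m)) * f (O ∩ W)) ⊎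
          ∃[ i ] (fromℕ (2 ℕ.* m ℕ.+ 1) * t ≤ fromℕ (6 ℕ.* (2 ℕ.+ m)) * f (S i))
        valuable-part {suc k′} {t} m W _ ∣O∣≤k 0≤t t≤fO small =
          [ inj₁ , (λ le → inj₂ (i , le)) ]′ (+-≤-split (+-cancelʳ-≤ (fromℕ 2 * p * t) (begin
            q * t + q * t + fromℕ 2 * p * t
              ≈⟨ +-cong (+-cong (*-congʳ q≈) (*-congʳ q≈)) (*-congʳ (*-congˡ p≈)) ⟩
            (fromℕ 2 * fromℕ m + fromℕ 1) * t + (fromℕ 2 * fromℕ m + fromℕ 1) * t
            + fromℕ 2 * (fromℕ 2 + fromℕ m) * t
              -- `2 (2 p - 3) + 2 p = 6 (p - 1)`: the part `2 p` pays for the small marginals, and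
              -- the rest is shared evenly by `O ∩ W` and `S i`.
              ≈⟨ solve 2 (λ m t → (con 2 :* m :+ con 1) :* t :+ (con 2 :* m :+ con 1) :* t :+ con 2 :* (con 2 :+ m) :* t
                   := con 6 :* ((con 1 :+ m) :* t)) refl (fromℕ m) t ⟩
            fromℕ 6 * ((fromℕ 1 + fromℕ m) * t)    ≈⟨ *-congˡ (*-congʳ (fromℕ-+ 1 m)) ⟨
            fromℕ 6 * (fromℕ (suc m) * t)
              ≤⟨ *-monoʳ-≤ (0≤fromℕ 6) (≤-trans (*-monoʳ-≤ (0≤fromℕ (suc m)) t≤fO) large) ⟩
            fromℕ 6 * (p * f (O ∪ S i))
              ≈⟨ solve 2 (λ p x → con 6 :* (p :* x) := con 2 :* p :* (con 3 :* x)) refl p (f (O ∪ S i)) ⟩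
            fromℕ 2 * p * (fromℕ 3 * f (O ∪ S i))
              ≤⟨ *-monoʳ-≤ (*-nonNegative (0≤fromℕ 2) (0≤fromℕ (2 ℕ.+ m))) (bound i i<p) ⟩
            fromℕ 2 * p * (fromℕ 3 * (f (S i) + f (O ∩ W)) + t)
              ≈⟨ solve 4 (λ p x y t → con 2 :* p :* (con 3 :* (x :+ y) :+ t)
                   := con 6 :* p :* y :+ con 6 :* p :* x :+ con 2 :* p :* t) refl p (f (S i)) (f (O ∩ W)) t ⟩
            fromℕ 6 * p * f (O ∩ W) + fromℕ 6 * p * f (S i) + fromℕ 2 * p * t
              ≈⟨ +-congʳ (+-cong (*-congʳ (fromℕ-* 6 (2 ℕ.+ m))) (*-congʳ (fromℕ-* 6 (2 ℕ.+ m)))) ⟨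
            r * f (O ∩ W) + r * f (S i) + fromℕ 2 * p * t ∎)))
          where
          k : ℕ
          k = suc k′
          p q r : Carrier
          p = fromℕ (2 ℕ.+ m)
          q = fromℕ (2 ℕ.* m ℕ.+ 1)
          r = fromℕ (6 ℕ.* (2 ℕ.+ m))

          p≈ : p ≈ fromℕ 2 + fromℕ m
          p≈ = fromℕ-+ 2 m

          q≈ : q ≈ fromℕ 2 * fromℕ m + fromℕ 1
          q≈ = trans (fromℕ-+ (2 ℕ.* m) 1) (+-congʳ (fromℕ-* 2 m))

          found : ∃[ i ] (i ℕ.≤ suc m × fromℕ (suc m) * f O ≤ p * f (O ∪ S i))
          found = pigeonhole (suc m) p (fromℕ (suc m) * f O) (λ i → f (O ∪ S i))
            (*-monoʳ-≤ (0≤fromℕ (2 ℕ.+ m)) (∑-f-∪-≥′ (suc m)))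

          i : ℕ
          i = proj₁ found
          i<p : i ℕ.< 2 ℕ.+ m
          i<p = ℕ.s≤s (proj₁ (proj₂ found))
          large : fromℕ (suc m) * f O ≤ p * f (O ∪ S i)
          large = proj₂ (proj₂ found)

          R : Subset n
          R = O ∩ ∁ W

          bound : ∀ i → i ℕ.< 2 ℕ.+ m → fromℕ 3 * f (O ∪ S i) ≤ fromℕ 3 * (f (S i) + f (O ∩ W)) + t
          bound i i<p with enumerate R
          ... | xs , xs≡R , len = fromℕ-cancelˡ-≤ k′ (begin
            fromℕ k * (fromℕ 3 * f (O ∪ S i))
              ≈⟨ *-congˡ (*-congˡ (f-cong (≡.trans (≡.cong (_ ∪_) xs≡R) (q∪[p∩r]∪[p∩∁r]≡p∪q O (S i) W)))) ⟨
            fromℕ k * (fromℕ 3 * f (B ∪ toSubset xs)) ≈⟨ swap _ ⟩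
            fromℕ (3 ℕ.* k) * f (B ∪ toSubset xs)
              ≤⟨ f-∪-toSubset-≤ (0≤fromℕ (3 ℕ.* k)) 0≤t xs small′ ⟩
            fromℕ (3 ℕ.* k) * f B + fromℕ (length xs) * t
              ≤⟨ +-mono-≤ (*-monoʳ-≤ (0≤fromℕ (3 ℕ.* k)) (f-∪-≤ (S i) (O ∩ W)))
                (*-monoˡ-≤ 0≤t (fromℕ-mono-≤ ∣xs∣≤k)) ⟩
            fromℕ (3 ℕ.* k) * (f (S i) + f (O ∩ W)) + fromℕ k * t ≈⟨ +-congʳ (swap _) ⟨
            fromℕ k * (fromℕ 3 * (f (S i) + f (O ∩ W))) + fromℕ k * t ≈⟨ distribˡ _ _ _ ⟨
            fromℕ k * (fromℕ 3 * (f (S i) + f (O ∩ W)) + t) ∎)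
            where
            B : Subset n
            B = S i ∪ (O ∩ W)
            swap : ∀ x → fromℕ k * (fromℕ 3 * x) ≈ fromℕ (3 ℕ.* k) * x
            swap x = begin-equality
              fromℕ k * (fromℕ 3 * x)
                ≈⟨ solve 2 (λ k x → k :* (con 3 :* x) := con 3 :* k :* x) refl (fromℕ k) x ⟩
              fromℕ 3 * fromℕ k * x      ≈⟨ *-congʳ (fromℕ-* 3 k) ⟨
              fromℕ (3 ℕ.* k) * x        ∎
            small′ : ∀ {x} → x ∈ toSubset xs → SmallMarginal (fromℕ (3 ℕ.* k)) t B x
            small′ {x} x∈xs =
              let T , T⊆S , le = small {x} (x∈∁p⇒x∉p (proj₂ (x∈p∩q⁻ O (∁ W) (≡.subst (x ∈_) xs≡R x∈xs)))) i<p
              in T , p⊆p∪q (O ∩ W) ∘ T⊆S , le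
            ∣xs∣≤k : length xs ℕ.≤ k
            ∣xs∣≤k = ℕ.≤-trans (ℕ.≤-reflexive len) (ℕ.≤-trans (∣p∩q∣≤∣p∣ O (∁ W)) ∣O∣≤k)

-- Designating stored elements by masks.

Mask : Set
Mask = List Bool

at : Mask → ℕ → Bool
at []       _       = false
at (b ∷ bs) zero    = b
at (b ∷ bs) (suc i) = at bs i

bit : Bool → ℕ
bit b = if b then 1 else 0

popcount : Mask → ℕ
popcount []       = 0
popcount (b ∷ bs) = bit b ℕ.+ popcount bs

labelMask : ℕ → List ℕ → Mask
labelMask j = map (_≡ᵇ j)

chosen : ∀ {n} → Mask → List (Fin n) → Subset n
chosen bs xs = toSubset (select (at bs) xs)

select-all : ∀ {a} {A : Set a} {p : ℕ → Bool} → (∀ i → p i ≡ true) → (xs : List A) → select p xs ≡ xs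
select-all p≡true []       = ≡.refl
select-all p≡true (x ∷ xs) rewrite p≡true 0 = ≡.cong (x ∷_) (select-all (p≡true ∘ suc) xs)

length-select-at : ∀ {a} {A : Set a} bs (xs : List A) → length (select (at bs) xs) ℕ.≤ popcount bs
length-select-at bs           []       = z≤n
length-select-at []           (x ∷ xs) = length-select-at [] xs
length-select-at (true  ∷ bs) (x ∷ xs) = s≤s (length-select-at bs xs)
length-select-at (false ∷ bs) (x ∷ xs) = length-select-at bs xs

∣chosen∣≤popcount : ∀ {n} bs (xs : List (Fin n)) → ∣ chosen bs xs ∣ ℕ.≤ popcount bs
∣chosen∣≤popcount bs xs = ℕ.≤-trans (∣toSubset∣≤length (select (at bs) xs)) (length-select-at bs xs)

∈-toSubset⁺ : ∀ {n} {x : Fin n} {xs} → x List.∈ xs → x ∈ toSubset xs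
∈-toSubset⁺ {xs = x ∷ xs} (here ≡.refl) = x∈⁅x⁆∪p x (toSubset xs)
∈-toSubset⁺ {xs = x ∷ xs} (there x∈)  = q⊆p∪q ⁅ x ⁆ (toSubset xs) (∈-toSubset⁺ x∈)

∈-chosen⁻ : ∀ {n} {x : Fin n} bs xs → x ∈ chosen bs xs → x List.∈ xs
∈-chosen⁻ bs           []       x∈ = contradiction x∈ ∉⊥
∈-chosen⁻ []           (y ∷ xs) x∈ = there (∈-chosen⁻ [] xs x∈)
∈-chosen⁻ (false ∷ bs) (y ∷ xs) x∈ = there (∈-chosen⁻ bs xs x∈)
∈-chosen⁻ (true  ∷ bs) (y ∷ xs) x∈ with x∈p∪q⁻ ⁅ y ⁆ (chosen bs xs) x∈
... | inj₁ x∈⁅y⁆ = here (x∈⁅y⁆⇒x≡y y x∈⁅y⁆)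
... | inj₂ x∈′   = there (∈-chosen⁻ bs xs x∈′)

∣chosen∣-unique : ∀ {n} (h : Fin n → Bool) {xs} → Unique xs → popcount (map h xs) ≡ ∣ chosen (map h xs) xs ∣
∣chosen∣-unique {n} h []                      = ≡.sym (∣⊥∣≡0 n)
∣chosen∣-unique {n} h {x ∷ xs} (x∉xs ∷ uniq) with h x
... | false = ∣chosen∣-unique h uniq
... | true  = ≡.trans (≡.cong suc (∣chosen∣-unique h uniq)) (≡.sym (x∉p⇒∣⁅x⁆∪p∣≡1+∣p∣
  (λ x∈ → All.lookup x∉xs (∈-chosen⁻ (map h xs) xs x∈) ≡.refl)))

memberMask : ∀ {n} → Subset n → List (Fin n) → Mask
memberMask p = map (λ x → does (x ∈? p))

chosen-memberMask : ∀ {n} (p : Subset n) xs → chosen (memberMask p xs) xs ≡ p ∩ toSubset xs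
chosen-memberMask p []       = ≡.sym (∩-zeroʳ p)
chosen-memberMask p (x ∷ xs) with x ∈? p | chosen-memberMask p xs
... | yes x∈p | ih = ≡.trans
  (≡.cong₂ _∪_ (≡.sym p∩⁅x⁆≡⁅x⁆) ih)
  (≡.sym (∩-distribˡ-∪ p ⁅ x ⁆ (toSubset xs)))
  where
  p∩⁅x⁆≡⁅x⁆ : p ∩ ⁅ x ⁆ ≡ ⁅ x ⁆
  p∩⁅x⁆≡⁅x⁆ = ⊆-antisym (p∩q⊆q p ⁅ x ⁆)
    (λ y∈ → x∈p∩q⁺ (≡.subst (_∈ p) (≡.sym (x∈⁅y⁆⇒x≡y x y∈)) x∈p , y∈))
... | no x∉p | ih = ≡.trans
  (≡.trans ih (≡.sym (≡.trans (≡.cong (_∪ _) p∩⁅x⁆≡⊥) (∪-identityˡ _))))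
  (≡.sym (∩-distribˡ-∪ p ⁅ x ⁆ (toSubset xs)))
  where
  p∩⁅x⁆≡⊥ : p ∩ ⁅ x ⁆ ≡ ⊥
  p∩⁅x⁆≡⊥ = Empty-unique λ { (y , y∈) → let y∈p , y∈⁅x⁆ = x∈p∩q⁻ p ⁅ x ⁆ y∈ in
    x∉p (≡.subst (_∈ p) (x∈⁅y⁆⇒x≡y x y∈⁅x⁆) y∈p) }

-- The machine cannot compare elements, so its feasibility test counts positions. Without
-- repetitions the positions of `p` are no more than its elements, and the mask of `OPT ∩ A` passes
-- the test.
popcount-memberMask : ∀ {n} (p : Subset n) {xs} → Unique xs → popcount (memberMask p xs) ℕ.≤ ∣ p ∣
popcount-memberMask p {xs} uniq = ℕ.≤-trans
  (ℕ.≤-reflexive (≡.trans (∣chosen∣-unique _ uniq) (≡.cong ∣_∣ (chosen-memberMask p xs))))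
  (∣p∩q∣≤∣p∣ p (toSubset xs))

bit-<ᵇ-suc : ∀ l j → bit (l <ᵇ suc j) ≡ bit (l <ᵇ j) ℕ.+ bit (l ≡ᵇ j)
bit-<ᵇ-suc zero    zero    = ≡.refl
bit-<ᵇ-suc zero    (suc j) = ≡.refl
bit-<ᵇ-suc (suc l) zero    = ≡.refl
bit-<ᵇ-suc (suc l) (suc j) = bit-<ᵇ-suc l j

popcount-<ᵇ-suc : ∀ j ls →
  popcount (map (_<ᵇ suc j) ls) ≡ popcount (map (_<ᵇ j) ls) ℕ.+ popcount (labelMask j ls)
popcount-<ᵇ-suc j []       = ≡.refl
popcount-<ᵇ-suc j (l ∷ ls) = ≡.trans (≡.cong₂ ℕ._+_ (bit-<ᵇ-suc l j) (popcount-<ᵇ-suc j ls))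
  (CommutativeSemigroup.interchange ℕ.+-commutativeSemigroup (bit (l <ᵇ j)) _ _ _)

popcount-<ᵇ-≤ : ∀ {k ls} → (∀ j → popcount (labelMask j ls) ℕ.≤ k) →
  ∀ p → popcount (map (_<ᵇ p) ls) ℕ.≤ p ℕ.* k
popcount-<ᵇ-≤ {ls = ls} le zero = ℕ.≤-reflexive (none ls)
  where
  none : ∀ ls → popcount (map (_<ᵇ 0) ls) ≡ 0
  none []       = ≡.refl
  none (l ∷ ls) = none ls
popcount-<ᵇ-≤ {k} {ls} le (suc p) = ℕ.≤-trans (ℕ.≤-reflexive (popcount-<ᵇ-suc p ls))
  (ℕ.≤-trans (ℕ.+-mono-≤ (popcount-<ᵇ-≤ {ls = ls} le p) (le p)) (ℕ.≤-reflexive (ℕ.+-comm (p ℕ.* k) k)))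

-- Counts positions class by class: the mask of the labels below `j + 1` is that of the labels below
-- `j` together with the class of `j`.
length-labels : ∀ {k p ls} → All (ℕ._< p) ls → (∀ j → popcount (labelMask j ls) ℕ.≤ k) → length ls ℕ.≤ p ℕ.* k
length-labels {k} {p} {ls} below le = ℕ.≤-trans (ℕ.≤-reflexive (all ls below)) (popcount-<ᵇ-≤ {ls = ls} le p)
  where
  all : ∀ ls → All (ℕ._< p) ls → length ls ≡ popcount (map (_<ᵇ p) ls)
  all []       []          = ≡.refl
  all (l ∷ ls) (l<p ∷ below) with l <ᵇ p | ℕ.<⇒<ᵇ l<p
  ... | true | _ = ≡.cong suc (all ls below)

-- Masks are enumerated as binary numerals, least significant bit first.

decrement : Mask → Maybe Mask
decrement []           = nothing
decrement (true  ∷ bs) = just (false ∷ bs)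
decrement (false ∷ bs) = Maybe.map (true ∷_) (decrement bs)

value : Mask → ℕ
value []       = 0
value (b ∷ bs) = bit b ℕ.+ 2 ℕ.* value bs

decrement-just : ∀ bs {bs′} → decrement bs ≡ just bs′ → value bs ≡ suc (value bs′) × length bs ≡ length bs′
decrement-just (true  ∷ bs) ≡.refl = ≡.refl , ≡.refl
decrement-just (false ∷ bs) eq with decrement bs | decrement-just bs
decrement-just (false ∷ bs) ≡.refl | just bs′ | ih with ih ≡.refl
... | val , len rewrite val = double (value bs′) , ≡.cong suc len
  where
  double : ∀ v → 2 ℕ.* suc v ≡ suc (1 ℕ.+ 2 ℕ.* v)
  double = solve-∀

decrement-nothing : ∀ bs → decrement bs ≡ nothing → value bs ≡ 0
decrement-nothing []           eq = ≡.refl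
decrement-nothing (false ∷ bs) eq with decrement bs | decrement-nothing bs
... | nothing | ih rewrite ih ≡.refl = ≡.refl

value-injective : ∀ bs cs → length bs ≡ length cs → value bs ≡ value cs → bs ≡ cs
value-injective []           []           _   _  = ≡.refl
value-injective (true  ∷ bs) (true  ∷ cs) len eq =
  ≡.cong (true ∷_) (value-injective bs cs (ℕ.suc-injective len) (ℕ.*-cancelˡ-≡ _ _ 2 (ℕ.suc-injective eq)))
value-injective (false ∷ bs) (false ∷ cs) len eq =
  ≡.cong (false ∷_) (value-injective bs cs (ℕ.suc-injective len) (ℕ.*-cancelˡ-≡ _ _ 2 eq))
value-injective (true  ∷ bs) (false ∷ cs) len eq = contradiction (≡.sym eq) (ℕ.even≢odd (value cs) (value bs))
value-injective (false ∷ bs) (true  ∷ cs) len eq = contradiction eq (ℕ.even≢odd (value bs) (value cs))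

value-≤-all-true : ∀ {a} {A : Set a} (xs : List A) bs → length bs ≡ length xs →
  value bs ℕ.≤ value (map (λ _ → true) xs)
value-≤-all-true []       []           len = z≤n
value-≤-all-true (x ∷ xs) (b ∷ bs) len =
  ℕ.+-mono-≤ (bit≤1 b) (ℕ.*-monoʳ-≤ 2 (value-≤-all-true xs bs (ℕ.suc-injective len)))
  where
  bit≤1 : ∀ b → bit b ℕ.≤ 1
  bit≤1 true  = s≤s z≤n
  bit≤1 false = z≤n

-- Prefix-free codes for the control state.

Encoder : Set → Set
Encoder A = A → List Bool → List Bool

-- An encoder writes in front of a given tail. Since the tails are arbitrary and recovered as well,
-- decoding a state is a chain of such steps, without any reasoning about append.
PrefixFree : ∀ {A} → Encoder A → Set
PrefixFree enc = ∀ x y {r s} → enc x r ≡ enc y s → x ≡ y × r ≡ s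

-- Unary is cheap enough: the index and the labels are at most `p`, which is constant for fixed `ε`,
-- and beyond the phase number there is only a single `k`.
encodeℕ : Encoder ℕ
encodeℕ zero    r = false ∷ r
encodeℕ (suc n) r = true ∷ encodeℕ n r

encodeℕ-prefixFree : PrefixFree encodeℕ
encodeℕ-prefixFree zero    zero    ≡.refl = ≡.refl , ≡.refl
encodeℕ-prefixFree (suc m) (suc n) eq with encodeℕ-prefixFree m n (∷-injectiveʳ eq)
... | ≡.refl , r≡s = ≡.refl , r≡s

encodeList : ∀ {A} → Encoder A → Encoder (List A)
encodeList enc []       r = false ∷ r
encodeList enc (x ∷ xs) r = true ∷ enc x (encodeList enc xs r)

encodeList-prefixFree : ∀ {A} {enc : Encoder A} → PrefixFree enc → PrefixFree (encodeList enc)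
encodeList-prefixFree pf []       []       ≡.refl = ≡.refl , ≡.refl
encodeList-prefixFree pf (x ∷ xs) (y ∷ ys) eq with pf x y (∷-injectiveʳ eq)
... | ≡.refl , eq′ with encodeList-prefixFree pf xs ys eq′
...   | ≡.refl , r≡s = ≡.refl , r≡s

encodeBool-prefixFree : PrefixFree {Bool} _∷_
encodeBool-prefixFree x y ≡.refl = ≡.refl , ≡.refl

length-encodeℕ : ∀ n r → length (encodeℕ n r) ≡ suc n ℕ.+ length r
length-encodeℕ zero    r = ≡.refl
length-encodeℕ (suc n) r = ≡.cong suc (length-encodeℕ n r)

length-encodeList : ∀ {A} {enc : Encoder A} {c xs} → All (λ x → ∀ r → length (enc x r) ℕ.≤ c ℕ.+ length r) xs →
  ∀ r → length (encodeList enc xs r) ℕ.≤ suc (length xs ℕ.* suc c) ℕ.+ length r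
length-encodeList [] r = ℕ.≤-refl
length-encodeList {enc = enc} {c} {x ∷ xs} (le ∷ les) r = s≤s (ℕ.≤-trans (le _)
  (ℕ.≤-trans (ℕ.+-monoʳ-≤ c (length-encodeList les r))
    (ℕ.≤-reflexive (rearrange c (length xs ℕ.* suc c) (length r)))))
  where
  rearrange : ∀ c l r → c ℕ.+ (suc l ℕ.+ r) ≡ suc (c ℕ.+ l) ℕ.+ r
  rearrange = solve-∀

-- The machine.

data Phase : Set where
  reading : Phase
  trial₀ trial₁ trial₂ trial₃ trial₄ trial₅ accept reject : Phase
  search₀ search₁ search₂ search₃ search₄ search₅ advance : Phase
  found : Phase

-- A table that inverts `phaseNumber`, so that injectivity takes 17 cases instead of 17 squared.
phases : List Phase
phases = reading ∷ trial₀ ∷ trial₁ ∷ trial₂ ∷ trial₃ ∷ trial₄ ∷ trial₅ ∷ accept ∷ reject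
  ∷ search₀ ∷ search₁ ∷ search₂ ∷ search₃ ∷ search₄ ∷ search₅ ∷ advance ∷ found ∷ []

phaseNumber : Phase → ℕ
phaseNumber reading = 0
phaseNumber trial₀  = 1
phaseNumber trial₁  = 2
phaseNumber trial₂  = 3
phaseNumber trial₃  = 4
phaseNumber trial₄  = 5
phaseNumber trial₅  = 6
phaseNumber accept  = 7
phaseNumber reject  = 8
phaseNumber search₀ = 9
phaseNumber search₁ = 10
phaseNumber search₂ = 11
phaseNumber search₃ = 12
phaseNumber search₄ = 13
phaseNumber search₅ = 14
phaseNumber advance = 15
phaseNumber found   = 16

phases-phaseNumber : ∀ φ → head (drop (phaseNumber φ) phases) ≡ just φ × phaseNumber φ ℕ.≤ 16
phases-phaseNumber reading = ≡.refl , ℕ.≤ᵇ⇒≤ _ _ _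
phases-phaseNumber trial₀  = ≡.refl , ℕ.≤ᵇ⇒≤ _ _ _
phases-phaseNumber trial₁  = ≡.refl , ℕ.≤ᵇ⇒≤ _ _ _
phases-phaseNumber trial₂  = ≡.refl , ℕ.≤ᵇ⇒≤ _ _ _
phases-phaseNumber trial₃  = ≡.refl , ℕ.≤ᵇ⇒≤ _ _ _
phases-phaseNumber trial₄  = ≡.refl , ℕ.≤ᵇ⇒≤ _ _ _
phases-phaseNumber trial₅  = ≡.refl , ℕ.≤ᵇ⇒≤ _ _ _
phases-phaseNumber accept  = ≡.refl , ℕ.≤ᵇ⇒≤ _ _ _
phases-phaseNumber reject  = ≡.refl , ℕ.≤ᵇ⇒≤ _ _ _
phases-phaseNumber search₀ = ≡.refl , ℕ.≤ᵇ⇒≤ _ _ _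
phases-phaseNumber search₁ = ≡.refl , ℕ.≤ᵇ⇒≤ _ _ _
phases-phaseNumber search₂ = ≡.refl , ℕ.≤ᵇ⇒≤ _ _ _
phases-phaseNumber search₃ = ≡.refl , ℕ.≤ᵇ⇒≤ _ _ _
phases-phaseNumber search₄ = ≡.refl , ℕ.≤ᵇ⇒≤ _ _ _
phases-phaseNumber search₅ = ≡.refl , ℕ.≤ᵇ⇒≤ _ _ _
phases-phaseNumber advance = ≡.refl , ℕ.≤ᵇ⇒≤ _ _ _
phases-phaseNumber found   = ≡.refl , ℕ.≤ᵇ⇒≤ _ _ _

phaseNumber-injective : Injective _≡_ _≡_ phaseNumber
phaseNumber-injective {φ} {ψ} eq = just-injective (≡.trans (≡.sym (proj₁ (phases-phaseNumber φ)))
  (≡.trans (≡.cong (λ i → head (drop i phases)) eq) (proj₁ (phases-phaseNumber ψ))))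

-- `labels` runs parallel to the stored elements and records the `S_i` of each one; the partition
-- lives in the control state because elements are opaque. `mask` is the current candidate of the
-- search or the final output.
record ControlState : Set where
  constructor control
  field
    phase  : Phase
    bound  : ℕ
    index  : ℕ
    labels : List ℕ
    mask   : Mask

encodeState : ControlState → List Bool
encodeState (control φ k i ls bs) =
  encodeℕ (phaseNumber φ) (encodeℕ k (encodeℕ i (encodeList encodeℕ ls (encodeList _∷_ bs []))))

encodeState-injective : Injective _≡_ _≡_ encodeState
encodeState-injective {control φ k i ls bs} {control φ′ k′ i′ ls′ bs′} eq
  with encodeℕ-prefixFree (phaseNumber φ) (phaseNumber φ′) eq
... | φ≡ , eq₁ with phaseNumber-injective {φ} {φ′} φ≡ | encodeℕ-prefixFree k k′ eq₁
... | ≡.refl | ≡.refl , eq₂ with encodeℕ-prefixFree i i′ eq₂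
... | ≡.refl , eq₃ with encodeList-prefixFree encodeℕ-prefixFree ls ls′ eq₃
... | ≡.refl , eq₄ with encodeList-prefixFree encodeBool-prefixFree bs bs′ eq₄
... | ≡.refl , _ = ≡.refl

-- In phase trial₀ with index i the newest element has been tried against the sets
-- with labels i, ..., m + 1.  At the end of a round of trial or of search the
-- numbers are five temporaries followed by τ, which is therefore at position 5.
-- The search never runs out of masks, so the empty mask in phase advance is a dummy.
module _ (m : ℕ) where

  program : ControlState → Instruction ControlState
  program (control reading k i ls bs) =
    read (control trial₀ k (2 ℕ.+ m) ls []) (control search₀ k 0 ls (map (λ _ → true) ls))
  -- All sets have refused the newest element, which is at position 0 and is discarded.
  program (control trial₀ k zero ls bs)    = keepElements (0 <ᵇ_) (control reading k 0 ls [])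
  program (control trial₀ k (suc i) ls bs) = query (at (true ∷ labelMask i ls)) (control trial₁ k i ls bs)
  program (control trial₁ k i ls bs) = query (at (false ∷ labelMask i ls)) (control trial₂ k i ls bs)
  program (control trial₂ k i ls bs) = arith sub 1 0 (control trial₃ k i ls bs)
  program (control trial₃ k i ls bs) = constant (3 ℕ.* k) (control trial₄ k i ls bs)
  program (control trial₄ k i ls bs) = arith mul 0 1 (control trial₅ k i ls bs)
  program (control trial₅ k i ls bs) = compare 5 0 (control accept k i ls bs) (control reject k i ls bs)
  program (control accept k i ls bs) = keepNumbers (_≡ᵇ 5)
    (if popcount (labelMask i (i ∷ ls)) <ᵇ k
     then control reading k 0 (i ∷ ls) []
     else control found k 0 [] (labelMask i (i ∷ ls)))
  program (control reject k i ls bs) = keepNumbers (_≡ᵇ 5) (control trial₀ k i ls bs)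
  program (control search₀ k i ls bs) = query (at bs) (control search₁ k i ls bs)
  program (control search₁ k i ls bs) = constant (6 ℕ.* (2 ℕ.+ m)) (control search₂ k i ls bs)
  program (control search₂ k i ls bs) = arith mul 0 1 (control search₃ k i ls bs)
  program (control search₃ k i ls bs) = constant (2 ℕ.* m ℕ.+ 1) (control search₄ k i ls bs)
  -- The numbers are now `2 m + 1`, `6 p f(T)`, `6 p`, `f(T)`, `τ`. The product pushes `6 p f(T)` to
  -- position 2, where the comparison expects it.
  program (control search₄ k i ls bs) = arith mul 0 4 (control search₅ k i ls bs)
  program (control search₅ k i ls bs) = compare 0 2
    (if popcount bs ≤ᵇ k then control found k i ls bs else control advance k i ls bs)
    (control advance k i ls bs)
  program (control advance k i ls bs) =
    keepNumbers (_≡ᵇ 5) (maybe′ (control search₀ k i ls) (control found k i ls []) (decrement bs))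
  program (control found k i ls bs) = output (at bs)

  machine : Machine
  machine = record
    { State          = ControlState
    ; code           = encodeState
    ; code-injective = encodeState-injective
    ; start          = λ k → control reading k 0 [] []
    ; program        = program
    }

-- Labelled elements and the sets they form.

Labelled : ℕ → Set
Labelled n = List (Fin n × ℕ)

labelled : ∀ {n} → ℕ → Labelled n → Subset n
labelled j A = chosen (labelMask j (map proj₂ A)) (map proj₁ A)

∈-labelled⁻ : ∀ {n j} {x : Fin n} A → x ∈ labelled j A → (x , j) List.∈ A
∈-labelled⁻ [] x∈ = contradiction x∈ ∉⊥
∈-labelled⁻ {j = j} ((y , l) ∷ A) x∈ with l ≡ᵇ j | ℕ.≡ᵇ⇒≡ l j
... | false | _ = there (∈-labelled⁻ A x∈)
... | true  | l≡j with x∈p∪q⁻ ⁅ y ⁆ (labelled j A) x∈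
...   | inj₁ x∈⁅y⁆ = here (≡.cong₂ _,_ (x∈⁅y⁆⇒x≡y y x∈⁅y⁆) (≡.sym (l≡j _)))
...   | inj₂ x∈′   = there (∈-labelled⁻ A x∈′)

labelled-⊆ : ∀ {n} j a (A : Labelled n) → labelled j A ⊆ labelled j (a ∷ A)
labelled-⊆ j (y , l) A x∈ with l ≡ᵇ j
... | false = x∈
... | true  = q⊆p∪q ⁅ y ⁆ (labelled j A) x∈

-- The source of disjointness: an element stored once has one label.
unique-label : ∀ {n i j} {x : Fin n} {A : Labelled n} → Unique (map proj₁ A) →
  (x , i) List.∈ A → (x , j) List.∈ A → i ≡ j
unique-label (x∉ ∷ _)  (here ≡.refl) (here ≡.refl) = ≡.refl
unique-label (x∉ ∷ _)  (here ≡.refl) (there xj∈)   =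
  contradiction ≡.refl (All.lookup x∉ (List.∈-map⁺ proj₁ xj∈))
unique-label (x∉ ∷ _)  (there xi∈)   (here ≡.refl) =
  contradiction ≡.refl (All.lookup x∉ (List.∈-map⁺ proj₁ xi∈))
unique-label (_ ∷ uniq) (there xi∈)   (there xj∈)  = unique-label uniq xi∈ xj∈

-- Correctness of the execution.

module _ {c ℓ₁ ℓ₂} (K : ArchimedeanOrderedField c ℓ₁ ℓ₂) where
  open ArchimedeanOrderedField K
  open OrderedFieldProperties K
  open Solver
  open PosetReasoning ≤-poset

  module Analysis (m : ℕ) {ε : Carrier} (I : Instance K ε) (0≤τ : 0# ≤ Instance.τ I) where
    open Instance I
    open Execution K (machine m) I
    open SubmodularFunction K f nonNegative submodular

    p : ℕ
    p = 2 ℕ.+ m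

    -- The additional 1 is the newest element while it is on trial.
    size : ℕ
    size = suc (p ℕ.* k)

    threshold : Carrier
    threshold = fromℕ (2 ℕ.* m ℕ.+ 1) * τ

    Valuable : Subset n → Set ℓ₂
    Valuable S = threshold ≤ fromℕ (6 ℕ.* p) * f S

    Good : Subset n → Set ℓ₂
    Good S = ∣ S ∣ ℕ.≤ k × Valuable S

    record WellFormed (s : ControlState) : Set where
      constructor wellFormed
      open ControlState s
      field
        bound≡k  : bound ≡ k
        index≤p  : index ℕ.≤ p
        labels<p : All (ℕ._< p) labels
        ∣labels∣ : length labels ℕ.≤ size
        ∣mask∣   : length mask ℕ.≤ size

    record Bounded (γ : Configuration) : Set where
      constructor bounded
      open Configuration γ
      field
        state-wellFormed : WellFormed state
        ∣elements∣       : length elements ℕ.≤ size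
        ∣numbers∣        : length numbers ℕ.≤ 6

    -- The whole future of a configuration: bounds at every step and a good set at the end. Being
    -- inductive it contains termination, and the absence of a constructor for `branch` makes the
    -- execution deterministic. As `step` is a function, every reachable configuration lies on this
    -- one path.
    data Correct : Configuration → Set (c ⊔ ℓ₂) where
      halts : ∀ {γ S} → Bounded γ → step γ ≡ halt S → Good S → Correct γ
      continues   : ∀ {γ γ′} → Bounded γ → step γ ≡ continue γ′ → Correct γ′ → Correct γ

    correct⇒bounded : ∀ {γ} → Correct γ → Bounded γ
    correct⇒bounded (halts b _ _) = b
    correct⇒bounded (continues b _ _)   = b

    reachable⇒correct : Correct initial → ∀ {γ} → Reachable γ → Correct γ
    reachable⇒correct ok here = ok
    reachable⇒correct ok (next r eq) with reachable⇒correct ok r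
    ... | halts _ eq′ _ with () ← ≡.trans (≡.sym eq) eq′
    ... | continues _ eq′ ok′ with ≡.refl ← ≡.trans (≡.sym eq) eq′ = ok′
    reachable⇒correct ok (left r eq) with reachable⇒correct ok r
    ... | halts _ eq′ _ with () ← ≡.trans (≡.sym eq) eq′
    ... | continues _ eq′ ok′ with () ← ≡.trans (≡.sym eq) eq′
    reachable⇒correct ok (right r eq) with reachable⇒correct ok r
    ... | halts _ eq′ _ with () ← ≡.trans (≡.sym eq) eq′
    ... | continues _ eq′ ok′ with () ← ≡.trans (≡.sym eq) eq′

    correct⇒good : ∀ {γ S} → Correct γ → step γ ≡ halt S → Good S
    correct⇒good (halts _ eq good) eq′ with ≡.refl ← ≡.trans (≡.sym eq) eq′ = good
    correct⇒good (continues _ eq _)      eq′ with () ← ≡.trans (≡.sym eq) eq′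

    correct⇒run : ∀ {γ} → Correct γ → ∃[ r ] ∃[ S ] (Good S × expectedValue {step γ} r ≡ f S)
    correct⇒run (halts {S = S} _ eq good) rewrite eq = halt S , S , good , ≡.refl
    correct⇒run (continues _ eq ok) with correct⇒run ok
    ... | r , S , good , val rewrite eq = continue r , S , good , val

    correct-dec : ∀ {a} {P : Set a} (d : Dec P) {q q′ es xs us} →
      (P → Correct (config q es xs us)) → (¬ P → Correct (config q′ es xs us)) →
      Correct (config (if does d then q else q′) es xs us)
    correct-dec (yes p) ok ok′ = ok p
    correct-dec (no ¬p) ok ok′ = ok′ ¬p

    correct-if : ∀ b {q q′ es xs us} →
      (b ≡ true → Correct (config q es xs us)) → (b ≡ false → Correct (config q′ es xs us)) →
      Correct (config (if b then q else q′) es xs us)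
    correct-if true  ok ok′ = ok ≡.refl
    correct-if false ok ok′ = ok′ ≡.refl

    module _ {es : List (Fin n)} (∣es∣ : length es ℕ.≤ size) where

      module _ {ls i} (ls<p : All (ℕ._< p) ls) (∣ls∣ : length ls ℕ.≤ size) (i≤p : i ℕ.≤ p) where

        bounded! : ∀ {φ bs xs us} → length bs ℕ.≤ size → T (length xs ≤ᵇ 6) →
          Bounded (config (control φ k i ls bs) es xs us)
        bounded! ∣bs∣ ∣xs∣ = bounded (wellFormed ≡.refl i≤p ls<p ∣ls∣ ∣bs∣) ∣es∣ (ℕ.≤ᵇ⇒≤ _ _ ∣xs∣)

        correct-found : ∀ {bs xs us} → length bs ℕ.≤ size → T (length xs ≤ᵇ 6) →
          popcount bs ℕ.≤ k → Valuable (chosen bs es) → Correct (config (control found k i ls bs) es xs us)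
        correct-found {bs} ∣bs∣ ∣xs∣ count val =
          halts (bounded! ∣bs∣ ∣xs∣) ≡.refl (ℕ.≤-trans (∣chosen∣≤popcount bs es) count , val)

        -- bs′ is a valuable mask that has not been examined yet.
        correct-search : ∀ v bs {us} bs′ → value bs ≡ v → length bs ℕ.≤ size →
          length bs′ ≡ length bs → value bs′ ℕ.≤ v → popcount bs′ ℕ.≤ k → Valuable (chosen bs′ es) →
          Correct (config (control search₀ k i ls bs) es (τ ∷ []) us)
        correct-search v bs bs′ eq ∣bs∣ len le count val =
          continues (bounded! ∣bs∣ _) ≡.refl
          (continues (bounded! ∣bs∣ _) ≡.refl
          (continues (bounded! ∣bs∣ _) ≡.refl
          (continues (bounded! ∣bs∣ _) ≡.refl
          (continues (bounded! ∣bs∣ _) ≡.refl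
          (continues (bounded! ∣bs∣ _) ≡.refl
          (correct-dec (_ ≤? _)
            (λ valuable → correct-if (popcount bs ≤ᵇ k)
              (λ small → correct-found ∣bs∣ _ (ℕ.≤ᵇ⇒≤ _ _ (≡.subst T (≡.sym small) _)) valuable)
              (λ large → continue-search λ { ≡.refl → ≡.subst T large (ℕ.≤⇒≤ᵇ count) }))
            (λ worthless → continue-search λ { ≡.refl → worthless val })))))))
          where
          continue-search : ∀ {x₀ x₁ x₂ x₃ x₄ us} → bs′ ≢ bs →
            Correct (config (control advance k i ls bs) es (x₀ ∷ x₁ ∷ x₂ ∷ x₃ ∷ x₄ ∷ τ ∷ []) us)
          continue-search {us = us} bs′≢bs =
            continues (bounded! ∣bs∣ _) ≡.refl (next-mask v eq le (decrement bs) ≡.refl)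
            where
            -- `v` is taken anew with its equation so that `suc v` can be matched, which makes the
            -- descent along the masks structural.
            next-mask : ∀ v → value bs ≡ v → value bs′ ℕ.≤ v → ∀ d → decrement bs ≡ d →
              Correct (config (maybe′ (control search₀ k i ls) (control found k i ls []) d) es (τ ∷ []) us)
            -- A current mask of value 0 leaves no candidate but itself, as masks of equal length
            -- are determined by their value; but `bs′` was shown to differ from it.
            next-mask v eq le nothing none =
              contradiction (value-injective bs′ bs len (≡.trans value′≡0 (≡.sym value≡0))) bs′≢bs
              where
              value≡0 : value bs ≡ 0
              value≡0 = decrement-nothing bs none
              value′≡0 : value bs′ ≡ 0
              value′≡0 = ℕ.n≤0⇒n≡0 (ℕ.≤-trans le (ℕ.≤-reflexive (≡.trans (≡.sym eq) value≡0)))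
            next-mask v eq le (just cs) dec with decrement-just bs dec
            next-mask zero    eq le (just cs) dec | val≡ , len≡ with () ← ≡.trans (≡.sym val≡) eq
            next-mask (suc v) eq le (just cs) dec | val≡ , len≡ =
              correct-search v cs bs′ (ℕ.suc-injective (≡.trans (≡.sym val≡) eq))
                (≡.subst (ℕ._≤ size) len≡ ∣bs∣) (≡.trans len len≡)
                (ℕ.s≤s⁻¹ (ℕ.≤∧≢⇒< le λ val′≡ →
                  bs′≢bs (value-injective bs′ bs len (≡.trans val′≡ (≡.sym eq)))))
                count val

    z : Carrier
    z = fromℕ (3 ℕ.* k)

    count : ℕ → Labelled n → ℕ
    count j A = popcount (labelMask j (map proj₂ A))

    Rejected : Labelled n → Fin n → Set ℓ₂
    Rejected A x = ∀ {j} → j ℕ.< p → SmallMarginal z τ (labelled j A) x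

    -- `count<k` is strict because a set that reaches `k` ends the run; hence accepting one more
    -- element still gives at most `k`. `covered` is all the history required: the sets only grow,
    -- and a rejection by a smaller set persists.
    record Invariant (A : Labelled n) (us : List (Fin n)) : Set ℓ₂ where
      field
        gain          : ∀ j → fromℕ (count j A) * τ ≤ z * f (labelled j A)
        count<k       : ∀ j → count j A ℕ.< k
        labels<p      : All (ℕ._< p) (map proj₂ A)
        unique        : Unique (map proj₁ A)
        unique-unread : Unique us
        fresh         : ∀ {x} → x List.∈ us → ¬ x List.∈ map proj₁ A
        covered       : ∀ x → x List.∈ us ⊎ x List.∈ map proj₁ A ⊎ Rejected A x

      ∣labels∣ : length (map proj₂ A) ℕ.≤ p ℕ.* k
      ∣labels∣ = length-labels labels<p (ℕ.<⇒≤ ∘ count<k)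

      ∣elements∣ : length (map proj₁ A) ℕ.≤ p ℕ.* k
      ∣elements∣ = ≡.subst (ℕ._≤ p ℕ.* k) (≡.trans (length-map proj₂ A) (≡.sym (length-map proj₁ A))) ∣labels∣

    initial-invariant : Invariant [] stream
    initial-invariant = record
      { gain          = λ j → ≤-trans (≤-reflexive (zeroˡ τ))
                          (*-nonNegative (0≤fromℕ (3 ℕ.* k)) (nonNegative _))
      ; count<k       = λ _ → k-positive
      ; labels<p      = []
      ; unique        = []
      ; unique-unread = Permutation.Unique-resp-↭ (≡.setoid (Fin n))
                          (↭⇒↭ₛ (↭-sym arrivalOrder)) (Unique.allFin⁺ n)
      ; fresh         = λ _ ()
      ; covered       = λ x → inj₁ (∈-resp-↭ (↭-sym arrivalOrder) (List.∈-allFin x))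
      }

    reject-invariant : ∀ {A u us} → Invariant A (u ∷ us) → Rejected A u → Invariant A us
    reject-invariant {A} {u} {us} inv rejected with u∉us ∷ uniq ← Invariant.unique-unread inv = record
      { Invariant inv
      ; unique-unread = uniq
      ; fresh         = Invariant.fresh inv ∘ there
      ; covered       = λ x → covered′ x (Invariant.covered inv x)
      }
      where
      covered′ : ∀ x → x List.∈ (u ∷ us) ⊎ x List.∈ map proj₁ A ⊎ Rejected A x →
        x List.∈ us ⊎ x List.∈ map proj₁ A ⊎ Rejected A x
      covered′ x (inj₁ (here ≡.refl)) = inj₂ (inj₂ rejected)
      covered′ x (inj₁ (there x∈us))  = inj₁ x∈us
      covered′ x (inj₂ rest)          = inj₂ rest

    z*[x-y]+z*y≈z*x : ∀ x y → z * (x - y) + z * y ≈ z * x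
    z*[x-y]+z*y≈z*x x y = trans (sym (distribˡ z (x - y) y)) (*-congˡ (x-y+y≈x x y))

    accept-gain : ∀ {A u us i} → Invariant A (u ∷ us) → τ ≤ z * (f (⁅ u ⁆ ∪ labelled i A) - f (labelled i A)) →
      ∀ j → fromℕ (count j ((u , i) ∷ A)) * τ ≤ z * f (labelled j ((u , i) ∷ A))
    accept-gain {A} {u} {us} {i} inv large j with i ≡ᵇ j | ℕ.≡ᵇ⇒≡ i j
    ... | false | _ = Invariant.gain inv j
    ... | true  | i≡j with ≡.refl ← i≡j _ = begin
      fromℕ (suc (count j A)) * τ
        ≈⟨ fromℕ-suc-* (count j A) τ ⟩
      τ + fromℕ (count j A) * τ
        ≤⟨ +-mono-≤ large (Invariant.gain inv j) ⟩
      z * (f (⁅ u ⁆ ∪ labelled j A) - f (labelled j A)) + z * f (labelled j A)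
        ≈⟨ z*[x-y]+z*y≈z*x _ _ ⟩
      z * f (⁅ u ⁆ ∪ labelled j A)                                              ∎

    accept-invariant : ∀ {A u us i} → Invariant A (u ∷ us) → i ℕ.< p →
      τ ≤ z * (f (⁅ u ⁆ ∪ labelled i A) - f (labelled i A)) →
      count i ((u , i) ∷ A) ℕ.< k → Invariant ((u , i) ∷ A) us
    accept-invariant {A} {u} {us} {i} inv i<p large small
      with u∉us ∷ uniq ← Invariant.unique-unread inv = record
      { gain          = accept-gain inv large
      ; count<k       = count<k′
      ; labels<p      = i<p ∷ Invariant.labels<p inv
      ; unique        = All.tabulate (λ x∈ u≡x → Invariant.fresh inv (here (≡.sym u≡x)) x∈)
                          ∷ Invariant.unique inv
      ; unique-unread = uniq
      ; fresh         = λ { x∈us (here ≡.refl) → All.lookup u∉us x∈us ≡.refl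
                          ; x∈us (there x∈A)   → Invariant.fresh inv (there x∈us) x∈A }
      ; covered       = λ x → covered′ x (Invariant.covered inv x)
      }
      where
      count<k′ : ∀ j → count j ((u , i) ∷ A) ℕ.< k
      count<k′ j with i ℕ.≟ j
      ... | yes ≡.refl = small
      ... | no i≢j with i ≡ᵇ j | ℕ.≡ᵇ⇒≡ i j
      ...   | true  | i≡j = contradiction (i≡j _) i≢j
      ...   | false | _   = Invariant.count<k inv j
      covered′ : ∀ x → x List.∈ (u ∷ us) ⊎ x List.∈ map proj₁ A ⊎ Rejected A x →
        x List.∈ us ⊎ x List.∈ (u ∷ map proj₁ A) ⊎ Rejected ((u , i) ∷ A) x
      covered′ x (inj₁ (here ≡.refl))  = inj₂ (inj₁ (here ≡.refl))
      covered′ x (inj₁ (there x∈us))   = inj₁ x∈us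
      covered′ x (inj₂ (inj₁ x∈A))     = inj₂ (inj₁ (there x∈A))
      covered′ x (inj₂ (inj₂ rejected)) = inj₂ (inj₂ λ {j} j<p →
        let S , S⊆ , le = rejected j<p in S , labelled-⊆ j (u , i) A ∘ S⊆ , le)

    -- The hypothesis means `f S ≥ τ / 3`, which exceeds the threshold of the search because
    -- `2 m + 1 ≤ 2 p`; so one guarantee covers both ways of halting.
    full-valuable : ∀ {S} → fromℕ k * τ ≤ z * f S → Valuable S
    full-valuable {S} le with s≤s {n = k′} _ ← k-positive = begin
      fromℕ (2 ℕ.* m ℕ.+ 1) * τ           ≤⟨ *-monoˡ-≤ 0≤τ (fromℕ-mono-≤ 2m+1≤2p) ⟩
      fromℕ (2 ℕ.* p) * τ                 ≤⟨ *-monoʳ-≤ (0≤fromℕ (2 ℕ.* p)) τ≤3f ⟩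
      fromℕ (2 ℕ.* p) * (fromℕ 3 * f S)   ≈⟨ *-congʳ (fromℕ-* 2 p) ⟩
      fromℕ 2 * fromℕ p * (fromℕ 3 * f S)
        ≈⟨ solve 2 (λ p x → con 2 :* p :* (con 3 :* x) := con 6 :* p :* x) refl (fromℕ p) (f S) ⟩
      fromℕ 6 * fromℕ p * f S             ≈⟨ *-congʳ (fromℕ-* 6 p) ⟨
      fromℕ (6 ℕ.* p) * f S               ∎
      where
      2m+1≤2p : 2 ℕ.* m ℕ.+ 1 ℕ.≤ 2 ℕ.* p
      2m+1≤2p = ℕ.≤-trans (ℕ.+-monoʳ-≤ (2 ℕ.* m) (s≤s z≤n))
        (ℕ.≤-reflexive (≡.trans (ℕ.+-comm (2 ℕ.* m) 4) (≡.sym (ℕ.*-distribˡ-+ 2 2 m))))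
      τ≤3f : τ ≤ fromℕ 3 * f S
      τ≤3f = fromℕ-cancelˡ-≤ k′ (begin
        fromℕ k * τ               ≤⟨ le ⟩
        fromℕ (3 ℕ.* k) * f S     ≈⟨ *-congʳ (fromℕ-* 3 k) ⟩
        fromℕ 3 * fromℕ k * f S
          ≈⟨ solve 2 (λ k x → con 3 :* k :* x := k :* (con 3 :* x)) refl (fromℕ k) (f S) ⟩
        fromℕ k * (fromℕ 3 * f S) ∎)

    -- The witness depends on `OPT`, which the machine does not know; the search needs only its
    -- existence.
    valuable-mask : ∀ {A} → Invariant A [] →
      ∃[ bs ] (length bs ≡ length (map proj₂ A) × popcount bs ℕ.≤ k × Valuable (chosen bs (map proj₁ A)))
    valuable-mask {A} inv
      with valuable-part (λ j → labelled j A)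
             (λ x∈i x∈j → unique-label (Invariant.unique inv) (∈-labelled⁻ A x∈i) (∈-labelled⁻ A x∈j))
             OPT m (toSubset (map proj₁ A)) k-positive (proj₁ optimal) 0≤τ τ-upper rejected
      where
      rejected : ∀ {x i} → x ∉ toSubset (map proj₁ A) → i ℕ.< p → SmallMarginal z τ (labelled i A) x
      rejected {x} x∉ i<p with Invariant.covered inv x
      ... | inj₂ (inj₁ x∈A)  = contradiction (∈-toSubset⁺ x∈A) x∉
      ... | inj₂ (inj₂ rej)  = rej i<p
    ... | inj₁ val = memberMask OPT (map proj₁ A) ,
      ≡.trans (length-map _ (map proj₁ A)) (≡.trans (length-map proj₁ A) (≡.sym (length-map proj₂ A))) ,
      ℕ.≤-trans (popcount-memberMask OPT (Invariant.unique inv)) (proj₁ optimal) ,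
      ≡.subst Valuable (≡.sym (chosen-memberMask OPT (map proj₁ A))) val
    ... | inj₂ (i , val) = labelMask i (map proj₂ A) , length-map _ (map proj₂ A) ,
      ℕ.<⇒≤ (Invariant.count<k inv i) , val

    -- Recursive together with `correct-trial`: a round of trials descends in the index, and the
    -- next read happens with a shorter stream.
    correct-reading : ∀ us {A} → Invariant A us →
      Correct (config (control reading k 0 (map proj₂ A) []) (map proj₁ A) (τ ∷ []) us)
    correct-trial : ∀ us {A u} i → Invariant A (u ∷ us) → i ℕ.≤ p →
      (∀ {j} → i ℕ.≤ j → j ℕ.< p → SmallMarginal z τ (labelled j A) u) →
      Correct (config (control trial₀ k i (map proj₂ A) []) (u ∷ map proj₁ A) (τ ∷ []) us)

    correct-reading [] {A} inv =
      let bs′ , len , pop , val = valuable-mask inv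
          len′ = length-map (λ _ → true) (map proj₂ A)
      in continues (bounded! ∣es∣ (Invariant.labels<p inv) ∣ls∣ z≤n z≤n _) ≡.refl
           (correct-search ∣es∣ (Invariant.labels<p inv) ∣ls∣ z≤n _ (map (λ _ → true) (map proj₂ A)) bs′ ≡.refl
             (≡.subst (ℕ._≤ size) (≡.sym len′) ∣ls∣) (≡.trans len (≡.sym len′))
             (value-≤-all-true (map proj₂ A) bs′ len) pop val)
      where
      ∣es∣ : length (map proj₁ A) ℕ.≤ size
      ∣es∣ = ℕ.m≤n⇒m≤1+n (Invariant.∣elements∣ inv)
      ∣ls∣ : length (map proj₂ A) ℕ.≤ size
      ∣ls∣ = ℕ.m≤n⇒m≤1+n (Invariant.∣labels∣ inv)
    correct-reading (u ∷ us) {A} inv =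
      continues (bounded! (ℕ.m≤n⇒m≤1+n (Invariant.∣elements∣ inv)) (Invariant.labels<p inv)
                  (ℕ.m≤n⇒m≤1+n (Invariant.∣labels∣ inv)) z≤n z≤n _) ≡.refl
        (correct-trial us p inv ℕ.≤-refl (λ p≤j j<p → contradiction p≤j (ℕ.<⇒≱ j<p)))

    correct-trial us {A} {u} zero inv _ rejected =
      continues (bounded! (s≤s (Invariant.∣elements∣ inv)) (Invariant.labels<p inv)
                  (ℕ.m≤n⇒m≤1+n (Invariant.∣labels∣ inv)) z≤n z≤n _)
        (≡.cong (λ es → continue (config (control reading k 0 (map proj₂ A) []) es (τ ∷ []) us))
          (select-all (λ _ → ≡.refl) (map proj₁ A)))
        (correct-reading us (reject-invariant inv (rejected z≤n)))
    correct-trial us {A} {u} (suc i) inv i<p rejected =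
      continues (bounded! ∣es∣ ls<p ∣ls∣ i<p z≤n _) ≡.refl
      (continues (b _) ≡.refl
      (continues (b _) ≡.refl
      (continues (b _) ≡.refl
      (continues (b _) ≡.refl
      (continues (b _) ≡.refl
      (correct-dec (_ ≤? _)
        (λ large → continues (b _) ≡.refl (correct-if (count i ((u , i) ∷ A) <ᵇ k)
          (λ small → correct-reading us
            (accept-invariant inv i<p large (ℕ.<ᵇ⇒< _ _ (≡.subst T (≡.sym small) _))))
          (λ full → correct-found ∣es∣ [] z≤n z≤n
            (s≤s (≡.subst (ℕ._≤ p ℕ.* k) (≡.sym (length-map _ (map proj₂ A))) (Invariant.∣labels∣ inv))) _
            (count≤k (i ≡ᵇ i))
            (full-valuable (≤-trans
              (*-monoˡ-≤ 0≤τ (fromℕ-mono-≤ {k} {count i ((u , i) ∷ A)}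
                (ℕ.≮⇒≥ λ small → ≡.subst T full (ℕ.<⇒<ᵇ small))))
              (accept-gain inv large i))))))
        (λ not-large → continues (b _) ≡.refl
          (correct-trial us i inv (ℕ.<⇒≤ i<p) (rejected′ (≰⇒≥ not-large))))))))))
      where
      ∣es∣ : length (u ∷ map proj₁ A) ℕ.≤ size
      ∣es∣ = s≤s (Invariant.∣elements∣ inv)
      ls<p : All (ℕ._< p) (map proj₂ A)
      ls<p = Invariant.labels<p inv
      ∣ls∣ : length (map proj₂ A) ℕ.≤ size
      ∣ls∣ = ℕ.m≤n⇒m≤1+n (Invariant.∣labels∣ inv)
      b : ∀ {φ xs} → T (length xs ≤ᵇ 6) →
        Bounded (config (control φ k i (map proj₂ A) []) (u ∷ map proj₁ A) xs us)
      b = bounded! ∣es∣ ls<p ∣ls∣ (ℕ.<⇒≤ i<p) z≤n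
      -- Stated for any bit because `i ≡ᵇ i` does not reduce for a variable `i`; both values respect
      -- the bound.
      count≤k : ∀ c → bit c ℕ.+ count i A ℕ.≤ k
      count≤k true  = Invariant.count<k inv i
      count≤k false = ℕ.<⇒≤ (Invariant.count<k inv i)
      rejected′ : z * (f (⁅ u ⁆ ∪ labelled i A) - f (labelled i A)) ≤ τ →
        ∀ {j} → i ℕ.≤ j → j ℕ.< p → SmallMarginal z τ (labelled j A) u
      rejected′ small {j} i≤j j<p with ℕ.m≤n⇒m<n∨m≡n i≤j
      ... | inj₁ i<j    = rejected i<j j<p
      ... | inj₂ ≡.refl = labelled i A , id , (begin
        z * f (⁅ u ⁆ ∪ labelled i A)
          ≈⟨ z*[x-y]+z*y≈z*x _ _ ⟨
        z * (f (⁅ u ⁆ ∪ labelled i A) - f (labelled i A)) + z * f (labelled i A)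
          ≤⟨ +-monoˡ-≤ _ small ⟩
        τ + z * f (labelled i A)                                                   ≈⟨ +-comm _ _ ⟩
        z * f (labelled i A) + τ                                                   ∎)

    correct-initial : Correct initial
    correct-initial = correct-reading stream initial-invariant

-- The memory bound.

length-encodeState-≤ : ∀ {k p s} φ i ls bs → i ℕ.≤ p → All (ℕ._< p) ls → length ls ℕ.≤ s → length bs ℕ.≤ s →
  length (encodeState (control φ k i ls bs)) ℕ.≤
  17 ℕ.+ (suc k ℕ.+ (suc p ℕ.+ (suc (s ℕ.* suc p) ℕ.+ suc (s ℕ.* 2))))
length-encodeState-≤ {k} {p} {s} φ i ls bs i≤p ls<p ∣ls∣≤s ∣bs∣≤s = begin
  length (encodeState (control φ k i ls bs))
    ≡⟨ length-encodeℕ (phaseNumber φ) _ ⟩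
  suc (phaseNumber φ) ℕ.+ length (encodeℕ k _)
    ≡⟨ ≡.cong (suc (phaseNumber φ) ℕ.+_) (length-encodeℕ k _) ⟩
  suc (phaseNumber φ) ℕ.+ (suc k ℕ.+ length (encodeℕ i _))
    ≡⟨ ≡.cong (λ l → suc (phaseNumber φ) ℕ.+ (suc k ℕ.+ l)) (length-encodeℕ i _) ⟩
  suc (phaseNumber φ) ℕ.+ (suc k ℕ.+ (suc i ℕ.+ length (encodeList encodeℕ ls _)))
    ≤⟨ ℕ.+-mono-≤ (s≤s (proj₂ (phases-phaseNumber φ))) (ℕ.+-monoʳ-≤ (suc k) (ℕ.+-mono-≤ (s≤s i≤p) lists)) ⟩
  17 ℕ.+ (suc k ℕ.+ (suc p ℕ.+ (suc (s ℕ.* suc p) ℕ.+ suc (s ℕ.* 2)))) ∎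
  where
  open ℕ.≤-Reasoning
  label : ∀ {l} → l ℕ.< p → ∀ r → length (encodeℕ l r) ℕ.≤ p ℕ.+ length r
  label {l} l<p r = ℕ.≤-trans (ℕ.≤-reflexive (length-encodeℕ l r)) (ℕ.+-monoˡ-≤ (length r) l<p)
  lists : length (encodeList encodeℕ ls (encodeList _∷_ bs [])) ℕ.≤ suc (s ℕ.* suc p) ℕ.+ suc (s ℕ.* 2)
  lists = begin
    length (encodeList encodeℕ ls (encodeList _∷_ bs []))
      ≤⟨ length-encodeList (All.map label ls<p) _ ⟩
    suc (length ls ℕ.* suc p) ℕ.+ length (encodeList _∷_ bs [])
      ≤⟨ ℕ.+-monoʳ-≤ (suc (length ls ℕ.* suc p))
           (length-encodeList {c = 1} (All.universal (λ _ _ → ℕ.≤-refl) bs) []) ⟩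
    suc (length ls ℕ.* suc p) ℕ.+ (suc (length bs ℕ.* 2) ℕ.+ 0)
      ≡⟨ ≡.cong (suc (length ls ℕ.* suc p) ℕ.+_) (ℕ.+-identityʳ _) ⟩
    suc (length ls ℕ.* suc p) ℕ.+ suc (length bs ℕ.* 2)
      ≤⟨ ℕ.+-mono-≤ (s≤s (ℕ.*-monoˡ-≤ (suc p) ∣ls∣≤s)) (s≤s (ℕ.*-monoˡ-≤ 2 ∣bs∣≤s)) ⟩
    suc (s ℕ.* suc p) ℕ.+ suc (s ℕ.* 2) ∎

memoryFactor : ℕ → ℕ → ℕ
memoryFactor p q = 28 ℕ.+ p ℕ.+ q ℕ.* (4 ℕ.+ p)

total-≤ : ∀ p q {k l} → 1 ℕ.≤ k → 1 ℕ.≤ l →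
  17 ℕ.+ (suc k ℕ.+ (suc p ℕ.+ (suc (q ℕ.* k ℕ.* suc p) ℕ.+ suc (q ℕ.* k ℕ.* 2)))) ℕ.+ q ℕ.* k ℕ.* l ℕ.+ 6
  ℕ.≤ memoryFactor p q ℕ.* (k ℕ.* l ℕ.^ 1)
total-≤ p q {suc x} {suc y} _ _ = ℕ.m+n≤o⇒m≤o _ (ℕ.≤-reflexive (identity p q x y))
  where
  identity : ∀ p q x y →
    17 ℕ.+ (suc (suc x) ℕ.+ (suc p ℕ.+ (suc (q ℕ.* suc x ℕ.* suc p) ℕ.+ suc (q ℕ.* suc x ℕ.* 2))))
    ℕ.+ q ℕ.* suc x ℕ.* suc y ℕ.+ 6
    -- The explicit slack: with `k = suc x` and `l = suc y` the inequality becomes a polynomial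
    -- identity.
    ℕ.+ ((27 ℕ.+ p) ℕ.* (x ℕ.+ y ℕ.+ x ℕ.* y) ℕ.+ (1 ℕ.+ q ℕ.* (3 ℕ.+ p)) ℕ.* (suc x ℕ.* y))
    ≡ (28 ℕ.+ p ℕ.+ q ℕ.* (4 ℕ.+ p)) ℕ.* (suc x ℕ.* (suc y ℕ.* 1))
  identity = solve-∀

-- Choice of the parameter and the resulting guarantees.

module _ {c ℓ₁ ℓ₂} (K : ArchimedeanOrderedField c ℓ₁ ℓ₂) where
  open ArchimedeanOrderedField K
  open OrderedFieldProperties K
  open Solver
  open PosetReasoning ≤-poset

  module _ {ε : Carrier} (0<ε : 0# < ε) (ε≤1 : ε ≤ 1#) where

    0≤ε : 0# ≤ ε
    0≤ε = proj₁ 0<ε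

    ε≉0 : ¬ ε ≈ 0#
    ε≉0 = proj₂ 0<ε ∘ sym

    0≤ε⁻¹ : 0# ≤ ε ⁻¹
    0≤ε⁻¹ = ⁻¹-nonNegative 0≤ε ε≉0

    1≤ε⁻¹ : 1# ≤ ε ⁻¹
    1≤ε⁻¹ = begin
      1#          ≈⟨ *-inverseʳ ε≉0 ⟨
      ε * ε ⁻¹    ≤⟨ *-monoˡ-≤ 0≤ε⁻¹ ε≤1 ⟩
      1# * ε ⁻¹   ≈⟨ *-identityˡ (ε ⁻¹) ⟩
      ε ⁻¹        ∎

    -- At most `p k + 1 ≤ (3 + m) k` elements are stored, and `m ≤ 12 / ε + 1`. As `1 ≤ 1 / ε`, the
    -- factor is at most `(3 + 12 + 1) / ε`, whence 16.
    parameter : ∃[ m ] (fromℕ 12 ≤ fromℕ m * ε × fromℕ (3 ℕ.+ m) ≤ fromℕ 16 * ε ⁻¹)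
    parameter with ceiling (*-nonNegative (0≤fromℕ 12) 0≤ε⁻¹)
    ... | m , lower , upper = m ,
      (begin
        fromℕ 12                 ≈⟨ *-identityʳ _ ⟨
        fromℕ 12 * 1#            ≈⟨ *-congˡ (*-inverseʳ ε≉0) ⟨
        fromℕ 12 * (ε * ε ⁻¹)
          ≈⟨ solve 3 (λ a b c → a :* (b :* c) := a :* c :* b) refl (fromℕ 12) ε (ε ⁻¹) ⟩
        fromℕ 12 * ε ⁻¹ * ε      ≤⟨ *-monoˡ-≤ 0≤ε lower ⟩
        fromℕ m * ε              ∎) ,
      (begin
        fromℕ (3 ℕ.+ m)                          ≈⟨ fromℕ-+ 3 m ⟩
        fromℕ 3 + fromℕ m                        ≤⟨ +-monoʳ-≤ (fromℕ 3) upper ⟩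
        fromℕ 3 + (fromℕ 12 * ε ⁻¹ + 1#)         ≈⟨ +-cong (*-identityʳ (fromℕ 3)) refl ⟨
        fromℕ 3 * 1# + (fromℕ 12 * ε ⁻¹ + 1#)
          ≤⟨ +-mono-≤ (*-monoʳ-≤ (0≤fromℕ 3) 1≤ε⁻¹) (+-monoʳ-≤ _ 1≤ε⁻¹) ⟩
        fromℕ 3 * ε ⁻¹ + (fromℕ 12 * ε ⁻¹ + ε ⁻¹)
          ≈⟨ solve 1 (λ x → con 3 :* x :+ (con 12 :* x :+ x) := con 16 :* x) refl (ε ⁻¹) ⟩
        fromℕ 16 * ε ⁻¹                          ∎)

    module Guarantees (m : ℕ) (12≤mε : fromℕ 12 ≤ fromℕ m * ε)
                      (3+m≤16ε⁻¹ : fromℕ (3 ℕ.+ m) ≤ fromℕ 16 * ε ⁻¹) (I : Instance K ε) where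
      open Instance I
      open Execution K (machine m) I

      -- Follows from the lower estimate because `ε / 8 ≤ 1` and `f OPT ≥ 0`.
      τ-nonNegative : 0# ≤ τ
      τ-nonNegative = ≤-trans (*-nonNegative (x≤y⇒0≤y-x ε÷8≤1) (nonNegative OPT)) τ-lower
        where
        ε÷8≤1 : ε ÷ fromℕ 8 ≤ 1#
        ε÷8≤1 = x≤y*z⇒x÷y≤z (0≤fromℕ 8) (fromℕ-suc≉0 7) (begin
          ε              ≤⟨ ε≤1 ⟩
          1#             ≤⟨ x≤x+y 1# (0≤fromℕ 7) ⟩
          fromℕ 8        ≈⟨ *-identityʳ (fromℕ 8) ⟨
          fromℕ 8 * 1#   ∎)

      open Analysis K m I τ-nonNegative

      size≤ : size ℕ.≤ (3 ℕ.+ m) ℕ.* k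
      size≤ = ℕ.+-monoˡ-≤ (p ℕ.* k) k-positive

      reachable⇒bounded : ∀ {γ} → Reachable γ → Bounded γ
      reachable⇒bounded r = correct⇒bounded (reachable⇒correct correct-initial r)

      elements-≤ : ∀ {γ} → Reachable γ → storedElements γ ℕ.≤ (3 ℕ.+ m) ℕ.* k
      elements-≤ r = ℕ.≤-trans (Bounded.∣elements∣ (reachable⇒bounded r)) size≤

      storage : ∀ {γ} → Reachable γ → fromℕ (storedElements γ) ≤ fromℕ 16 * (fromℕ k * ε ⁻¹)
      storage {γ} r = begin
        fromℕ (storedElements γ)          ≤⟨ fromℕ-mono-≤ (elements-≤ r) ⟩
        fromℕ ((3 ℕ.+ m) ℕ.* k)           ≈⟨ fromℕ-* (3 ℕ.+ m) k ⟩
        fromℕ (3 ℕ.+ m) * fromℕ k         ≤⟨ *-monoˡ-≤ (0≤fromℕ k) 3+m≤16ε⁻¹ ⟩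
        fromℕ 16 * ε ⁻¹ * fromℕ k
          ≈⟨ solve 3 (λ a b c → a :* b :* c := a :* (c :* b)) refl (fromℕ 16) (ε ⁻¹) (fromℕ k) ⟩
        fromℕ 16 * (fromℕ k * ε ⁻¹)       ∎

      bounded⇒memory-≤ : ∀ {γ} → Bounded γ →
        memory γ ℕ.≤ memoryFactor (2 ℕ.+ m) (3 ℕ.+ m) ℕ.* (k ℕ.* (1 ℕ.+ ⌊log₂ k ⌋ ℕ.+ ⌊log₂ n ⌋) ℕ.^ 1)
      bounded⇒memory-≤ {config (control φ _ i ls bs) es xs us}
        (bounded (wellFormed ≡.refl i≤p ls<p ∣ls∣ ∣bs∣) ∣es∣ ∣xs∣) = ℕ.≤-trans
        (ℕ.+-mono-≤
          (ℕ.+-mono-≤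
            (length-encodeState-≤ φ i ls bs i≤p ls<p (ℕ.≤-trans ∣ls∣ size≤) (ℕ.≤-trans ∣bs∣ size≤))
            (ℕ.*-mono-≤ (ℕ.≤-trans ∣es∣ size≤) (s≤s (ℕ.m≤n+m ⌊log₂ n ⌋ ⌊log₂ k ⌋))))
          ∣xs∣)
        (total-≤ p (3 ℕ.+ m) k-positive (s≤s z≤n))

      valuable⇒approximation : ∀ {S} → Valuable S → f OPT ÷ (fromℕ 3 + ε) ≤ f S
      valuable⇒approximation valuable =
        x≤y*z⇒x÷y≤z 0≤3+ε 3+ε≉0
          (guarantee m 0≤ε ε≤1 (nonNegative OPT) 12≤mε τ-nonNegative τ-lower valuable)
        where
        3≤3+ε : fromℕ 3 ≤ fromℕ 3 + ε
        3≤3+ε = x≤x+y (fromℕ 3) 0≤ε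
        0≤3+ε : 0# ≤ fromℕ 3 + ε
        0≤3+ε = ≤-trans (0≤fromℕ 3) 3≤3+ε
        3+ε≉0 : ¬ fromℕ 3 + ε ≈ 0#
        3+ε≉0 eq = fromℕ-suc≉0 2 (≤-antisym (≤-trans 3≤3+ε (≤-reflexive eq)) (0≤fromℕ 3))

      -- With a single execution the expectation is the value of the one set that is output.
      approximation : ∃[ r ] f OPT ÷ (fromℕ 3 + ε) ≤ expectedValue {step initial} r
      approximation = let r , S , (_ , valuable) , value≡ = correct⇒run correct-initial
        in r , ≡.subst (f OPT ÷ (fromℕ 3 + ε) ≤_) (≡.sym value≡) (valuable⇒approximation valuable)

      feasible : ∀ {γ S} → Reachable γ → step γ ≡ halt S → ∣ S ∣ ℕ.≤ k
      feasible r eq = proj₁ (correct⇒good (reachable⇒correct correct-initial r) eq)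

theorem3p9 : ∀ {c ℓ₁ ℓ₂} → Σ[ C ∈ ℕ ]
    ((K : ArchimedeanOrderedField c ℓ₁ ℓ₂) → let open ArchimedeanOrderedField K in
    ∀ ε → 0# < ε → ε ≤ 1# →
    Σ[ M ∈ Machine ]
    (IsSemiStreaming K ε M
    × IsApproximation K (fromℕ 3 + ε) ε M
    × StoresAtMost K (λ k → fromℕ C * (fromℕ k * ε ⁻¹)) ε M))
theorem3p9 = 16 , λ K ε 0<ε ε≤1 →
  let m , 12≤mε , 3+m≤16ε⁻¹ = parameter K 0<ε ε≤1
      open Guarantees K 0<ε ε≤1 m 12≤mε 3+m≤16ε⁻¹
  in machine m ,
     (memoryFactor (2 ℕ.+ m) (3 ℕ.+ m) , 1 , λ I γ r → bounded⇒memory-≤ I (reachable⇒bounded I r)) ,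
     (λ I → (λ γ S r eq → feasible I r eq) , approximation I) ,
     (λ I γ r → storage I r)
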